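{- For every fixed $d\geq 10$, the random graph $G(n,d/n)$ is almost surely $(16d,16d)$-degenerate.
   Context: $G(n,p)$ is the random graph on $n$ labeled vertices in which each edge appears independently with probability $p$; almost surely means with probability tending to $1$ as $n\to\infty$. A graph $H$ is $(d',\Delta)$-degenerate if there is an ordering $v_1,\ldots,v_n$ of its vertices such that for each $v_i$: (1) at most $d'$ vertices $v_j$ with $j<i$ are adjacent to $v_i$, and (2) there are at most $\Delta$ subsets $S\subset\{v_1,\ldots,v_i\}$ such that $S=N(v_j)\cap\{v_1,\ldots,v_i\}$ for some neighbor $v_j$ of $v_i$ with $j>i$, where $N(v)$ is the set of neighbors of $v$.
   Formalization: The fixed parameter d ≥ 10 is taken to be a rational number instead of an arbitrary real number. -}

module Defs where

open import Data.Bool using (Bool; true; false; _∧_; _∨_; not; if_then_else_)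
open import Data.Nat as ℕ using (ℕ; zero; suc; _≡ᵇ_; _<ᵇ_)
open import Data.Product using (_×_; _,_; proj₁; proj₂)
open import Data.List using (List; []; _∷_; _++_; map; filter; length; upTo; concatMap; foldr; take; drop; deduplicateᵇ)
open import Data.Bool.ListAction using (any; all)
open import Data.Integer using (+_)
open import Data.Rational using (ℚ; 0ℚ; 1ℚ; _+_; _*_; _-_; _/_; _≤ᵇ_)
open import Function using (_∘_)

-- Finite labelled graphs on the vertex set {0,…,n-1}.
-- A graph is given by its edge list, a sublist of `pairs n`
-- (the list of all pairs (i , j) with i < j < n).

pairs : ℕ → List (ℕ × ℕ)
pairs n = concatMap (λ j → map (λ i → (i , j)) (upTo j)) (upTo n)

sublists : {A : Set} → List A → List (List A)
sublists []       = [] ∷ []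
sublists (x ∷ xs) = let r = sublists xs in r ++ map (x ∷_) r

graphs : ℕ → List (List (ℕ × ℕ))
graphs n = sublists (pairs n)

Graph : Set
Graph = List (ℕ × ℕ)

adj : Graph → ℕ → ℕ → Bool
adj E u v = any (λ e → ((proj₁ e ≡ᵇ u) ∧ (proj₂ e ≡ᵇ v)) ∨ ((proj₁ e ≡ᵇ v) ∧ (proj₂ e ≡ᵇ u))) E

insertions : {A : Set} → A → List A → List (List A)
insertions x []       = (x ∷ []) ∷ []
insertions x (y ∷ ys) = (x ∷ y ∷ ys) ∷ map (y ∷_) (insertions x ys)

permutations : {A : Set} → List A → List (List A)
permutations []       = [] ∷ []
permutations (x ∷ xs) = concatMap (insertions x) (permutations xs)

listEqᵇ : List ℕ → List ℕ → Bool
listEqᵇ []       []       = true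
listEqᵇ (x ∷ xs) (y ∷ ys) = (x ≡ᵇ y) ∧ listEqᵇ xs ys
listEqᵇ _        _        = false

count : {A : Set} → (A → Bool) → List A → ℕ
count p = length ∘ filter (λ x → p x Data.Bool.≟ true)
  where import Data.Bool

-- (d' , Δ)-degeneracy (bounds given as rationals, compared with ≤ on ℚ).
-- For an ordering v₁,…,vₙ (a list `ord`) and position i (vertex v = vᵢ,
-- prefix = {v₁,…,vᵢ}, later = {v_{i+1},…,vₙ}):
--  (1) #{ j < i : vⱼ ~ vᵢ } ≤ d'
--  (2) #{ N(vⱼ) ∩ prefix : j > i, vⱼ ~ vᵢ } ≤ Δ   (number of distinct sets)
-- A subset of the prefix is represented by the sublist of `prefix`
-- it selects, so set equality is list equality.

ℕtoℚ : ℕ → ℚ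
ℕtoℚ k = (+ k) / 1

goodAt : Graph → ℚ → ℚ → List ℕ → ℕ → Bool
goodAt E d' Δ ord i =
  let prefix = take (suc i) ord
      earlier = take i ord
      later  = drop (suc i) ord
      v      = foldr (λ x _ → x) 0 (drop i ord)
      laterNbrs = filter (λ w → adj E v w Data.Bool.≟ true) later
      traces = map (λ w → filter (λ u → adj E w u Data.Bool.≟ true) prefix) laterNbrs
  in (ℕtoℚ (count (adj E v) earlier) ≤ᵇ d')
     ∧ (ℕtoℚ (length (deduplicateᵇ listEqᵇ traces)) ≤ᵇ Δ)
  where import Data.Bool

goodOrdering : Graph → ℚ → ℚ → List ℕ → Bool
goodOrdering E d' Δ ord = all (goodAt E d' Δ ord) (upTo (length ord))

degenerateᵇ : ℕ → ℚ → ℚ → Graph → Bool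
degenerateᵇ n d' Δ E = any (goodOrdering E d' Δ) (permutations (upTo n))

_^ℚ_ : ℚ → ℕ → ℚ
q ^ℚ zero  = 1ℚ
q ^ℚ suc k = q * (q ^ℚ k)

prob : ℕ → ℚ → (Graph → Bool) → ℚ
prob n p P =
  foldr _+_ 0ℚ
    (map (λ E → if P E
                  then (p ^ℚ length E) * ((1ℚ - p) ^ℚ (length (pairs n) ℕ.∸ length E))
                  else 0ℚ)
         (graphs n))

-- edge probability d/n  (n = 0 is irrelevant for asymptotics; set p = 0)
edgeProb : ℚ → ℕ → ℚ
edgeProb d zero    = 0ℚ
edgeProb d (suc m) = d * ((+ 1) / suc m)

AlmostSurely : ℚ → (ℕ → Graph → Bool) → Set
AlmostSurely d P =
  (ε : ℚ) → Data.Rational._<_ 0ℚ ε →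
  Σ ℕ λ N → (n : ℕ) → N ℕ.≤ n →
    Data.Rational._≤_ (1ℚ - ε) (prob n (edgeProb d n) (P n))
  where import Data.Rational
        open import Data.Product using (Σ)

{-# OPTIONS --safe #-}
module Submission where

-- The ordering is built from its last vertex backwards. Let R be the set of
-- vertices not yet placed. Call a vertex active if it lies in R or has at least
-- two neighbours in R. A vertex v of R with fewer than κ active neighbours can be
-- placed last among R: it has fewer than κ neighbours in R, and every inactive
-- later neighbour of v leaves the trace {v}, so there are at most κ traces.
--
-- Suppose no vertex of R can be placed, and put s = |R|.  Then at least κ s / 2
-- edges touch R.  Moreover some W outside R with |W| ≤ 2 s is such that R ∪ W
-- spans at least 4 s edges: take 2 s active vertices outside R, or all of them if
-- there are fewer.  The first event is unlikely for large s and the second one for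
-- small s.  With M a constant depending only on d, a Chernoff bound for each R
-- (and W) and a union bound, using the first event when M s > n and the second one
-- otherwise, give probability at most 2^(-s) M / n for each s, hence M / n in total.
--
-- Here D = ⌊d⌋ + 1 and κ = 14 D ≤ 16 d.  With d = a / b, multiplying the
-- probability of each graph by (b n)^(number of pairs) makes it a natural number,
-- so everything up to the final comparison takes place in ℕ.

open import Defs
open import Data.Bool using (Bool; true; false; T; T?; _∧_; _∨_; not; _≟_; if_then_else_)
open import Data.Bool.ListAction using (any; all)
open import Data.Bool.Properties using (∨-comm; ∨-zeroʳ)
open import Data.Empty using (⊥-elim)
open import Data.Integer as ℤ using (+_; -[1+_])
import Data.Integer.Properties as ℤ
open import Data.List using (List; []; _∷_; [_]; _++_; map; filter; length; upTo; take; drop; concatMap; deduplicateᵇ; foldr)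
open import Data.List.Membership.Propositional using (_∈_; find; lose)
open import Data.List.Membership.Propositional.Properties using (∈-++⁺ˡ; ∈-++⁺ʳ; ∈-++⁻; ∈-map⁺; ∈-map⁻; ∈-filter⁻; ∈-∃++; ∈-concatMap⁺; ∈-upTo⁻; ∈-upTo⁺)
open import Data.List.Properties using (++-assoc; ++-identityʳ; filter-++; length-filter; length-++; length-upTo; length-take; upTo-∷ʳ)
open import Data.List.Relation.Binary.Permutation.Propositional using (_↭_; ↭-sym; ↭-trans; ↭-refl)
import Data.List.Relation.Binary.Permutation.Propositional as Perm
open import Data.List.Relation.Binary.Permutation.Propositional.Properties using (drop-mid; ∈-resp-↭; ∷↭∷ʳ; shift; ↭-length; ↭-empty-inv)
open import Data.List.Relation.Binary.Sublist.Propositional using (_⊆_; []; _∷_; _∷ʳ_; ⊆-refl; ⊆-trans; lookup)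
open import Data.List.Relation.Binary.Sublist.Propositional.Properties using (filter-⊆; take-⊆; length-mono-≤; ++⁺)
open import Data.List.Relation.Unary.Any using (here; there; any?)
open import Data.Nat hiding (_≟_)
open import Data.Nat.Coprimality using (Coprime)
open import Data.Nat.DivMod
open import Data.Nat.Properties hiding (_≟_)
open import Data.Nat.Tactic.RingSolver using (solve-∀)
open import Data.Product using (Σ; _×_; _,_; proj₁; proj₂)
open import Data.Rational as ℚ using (ℚ; mkℚ; 0ℚ; 1ℚ; *≤*; *<*)
import Data.Rational.Properties as ℚ
open import Data.Rational.Unnormalised as ℚᵘ using (mkℚᵘ; *≡*; _≃_)
import Data.Rational.Unnormalised.Properties as ℚᵘ
open import Data.Sum using (_⊎_; inj₁; inj₂)
open import Function using (_∘_; id)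
open import Relation.Binary.PropositionalEquality hiding ([_])
open import Relation.Nullary using (¬_; ¬?; yes; no)

-- Finite sums

𝟙 : Bool → ℕ
𝟙 false = 0
𝟙 true  = 1

∑ : {A : Set} → List A → (A → ℕ) → ℕ
∑ []       f = 0
∑ (x ∷ xs) f = f x + ∑ xs f

𝟙≤1 : ∀ b → 𝟙 b ≤ 1
𝟙≤1 false = z≤n
𝟙≤1 true  = s≤s z≤n

𝟙-∧ : ∀ b c → 𝟙 (b ∧ c) ≡ 𝟙 b * 𝟙 c
𝟙-∧ false c = refl
𝟙-∧ true  c = sym (+-identityʳ (𝟙 c))

𝟙-∨-≤ : ∀ b c → 𝟙 (b ∨ c) ≤ 𝟙 b + 𝟙 c
𝟙-∨-≤ false c = ≤-refl
𝟙-∨-≤ true  c = s≤s z≤n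

module _ {A : Set} where

  ∑-mono : ∀ (xs : List A) {f g : A → ℕ} → (∀ x → f x ≤ g x) → ∑ xs f ≤ ∑ xs g
  ∑-mono []       h = z≤n
  ∑-mono (x ∷ xs) h = +-mono-≤ (h x) (∑-mono xs h)

  ∑-mono-∈ : ∀ (xs : List A) {f g : A → ℕ} → (∀ {x} → x ∈ xs → f x ≤ g x) → ∑ xs f ≤ ∑ xs g
  ∑-mono-∈ []       h = z≤n
  ∑-mono-∈ (x ∷ xs) h = +-mono-≤ (h (here refl)) (∑-mono-∈ xs (h ∘ there))

  ∑-cong : ∀ (xs : List A) {f g : A → ℕ} → (∀ x → f x ≡ g x) → ∑ xs f ≡ ∑ xs g
  ∑-cong []       h = refl
  ∑-cong (x ∷ xs) h = cong₂ _+_ (h x) (∑-cong xs h)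

  ∑-++ : ∀ (xs ys : List A) (f : A → ℕ) → ∑ (xs ++ ys) f ≡ ∑ xs f + ∑ ys f
  ∑-++ []       ys f = refl
  ∑-++ (x ∷ xs) ys f = trans (cong (λ t → f x + t) (∑-++ xs ys f)) (sym (+-assoc (f x) _ _))

  ∑-↭ : ∀ {xs ys : List A} (f : A → ℕ) → xs ↭ ys → ∑ xs f ≡ ∑ ys f
  ∑-↭ f Perm.refl = refl
  ∑-↭ f (Perm.prep x p) = cong (λ t → f x + t) (∑-↭ f p)
  ∑-↭ f (Perm.swap {ys = ys} x y p) rewrite ∑-↭ f p = lemma (f x) (f y) (∑ ys f)
    where
    lemma : ∀ a b c → a + (b + c) ≡ b + (a + c)
    lemma = solve-∀
  ∑-↭ f (Perm.trans p q) = trans (∑-↭ f p) (∑-↭ f q)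

  ∑-⊆ : ∀ {xs ys : List A} (f : A → ℕ) → xs ⊆ ys → ∑ xs f ≤ ∑ ys f
  ∑-⊆ f []          = z≤n
  ∑-⊆ f (y ∷ʳ p)    = ≤-trans (∑-⊆ f p) (m≤n+m _ (f y))
  ∑-⊆ f (refl ∷ p)  = +-monoʳ-≤ _ (∑-⊆ f p)

  ∑-zero : ∀ (xs : List A) → ∑ xs (λ _ → 0) ≡ 0
  ∑-zero []       = refl
  ∑-zero (x ∷ xs) = ∑-zero xs

  ∑-+ : ∀ (xs : List A) (f g : A → ℕ) → ∑ xs (λ x → f x + g x) ≡ ∑ xs f + ∑ xs g
  ∑-+ []       f g = refl
  ∑-+ (x ∷ xs) f g rewrite ∑-+ xs f g = lemma (f x) (g x) (∑ xs f) (∑ xs g)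
    where
    lemma : ∀ a b c d → a + b + (c + d) ≡ a + c + (b + d)
    lemma = solve-∀

  ∑-*ˡ : ∀ (xs : List A) c (f : A → ℕ) → ∑ xs (λ x → c * f x) ≡ c * ∑ xs f
  ∑-*ˡ []       c f = sym (*-zeroʳ c)
  ∑-*ˡ (x ∷ xs) c f rewrite ∑-*ˡ xs c f = sym (*-distribˡ-+ c (f x) _)

  ∑-*ʳ : ∀ (xs : List A) c (f : A → ℕ) → ∑ xs (λ x → f x * c) ≡ ∑ xs f * c
  ∑-*ʳ xs c f = begin
    ∑ xs (λ x → f x * c)  ≡⟨ ∑-cong xs (λ x → *-comm (f x) c) ⟩
    ∑ xs (λ x → c * f x)  ≡⟨ ∑-*ˡ xs c f ⟩
    c * ∑ xs f            ≡⟨ *-comm c _ ⟩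
    ∑ xs f * c            ∎
    where open ≡-Reasoning

  ∑-const : ∀ (xs : List A) c → ∑ xs (λ _ → c) ≡ length xs * c
  ∑-const []       c = refl
  ∑-const (x ∷ xs) c = cong (λ t → c + t) (∑-const xs c)

  ∑-lower-bound : ∀ (xs : List A) c {f : A → ℕ} → (∀ {x} → x ∈ xs → c ≤ f x) → length xs * c ≤ ∑ xs f
  ∑-lower-bound xs c h = ≤-trans (≤-reflexive (sym (∑-const xs c))) (∑-mono-∈ xs h)

  f≤∑ : ∀ {xs : List A} (f : A → ℕ) {x} → x ∈ xs → f x ≤ ∑ xs f
  f≤∑ f (here refl) = m≤m+n _ _
  f≤∑ f (there p)   = ≤-trans (f≤∑ f p) (m≤n+m _ _)

  ∑-filter : ∀ (p : A → Bool) (xs : List A) (f : A → ℕ) →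
             ∑ (filter (λ x → p x ≟ true) xs) f ≡ ∑ xs (λ x → 𝟙 (p x) * f x)
  ∑-filter p []       f = refl
  ∑-filter p (x ∷ xs) f with p x
  ... | false = ∑-filter p xs f
  ... | true  = cong₂ _+_ (sym (+-identityʳ (f x))) (∑-filter p xs f)

  length≡∑ : ∀ (xs : List A) → length xs ≡ ∑ xs (λ _ → 1)
  length≡∑ []       = refl
  length≡∑ (x ∷ xs) = cong suc (length≡∑ xs)

  length-filter≡∑ : ∀ (p : A → Bool) (xs : List A) →
                    length (filter (λ x → p x ≟ true) xs) ≡ ∑ xs (λ x → 𝟙 (p x))
  length-filter≡∑ p []       = refl
  length-filter≡∑ p (x ∷ xs) with p x
  ... | false = length-filter≡∑ p xs
  ... | true  = cong suc (length-filter≡∑ p xs)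

  𝟙-any≤∑ : ∀ (p : A → Bool) (xs : List A) → 𝟙 (any p xs) ≤ ∑ xs (λ x → 𝟙 (p x))
  𝟙-any≤∑ p []       = z≤n
  𝟙-any≤∑ p (x ∷ xs) = ≤-trans (𝟙-∨-≤ (p x) _) (+-monoʳ-≤ (𝟙 (p x)) (𝟙-any≤∑ p xs))

  any-∈ : ∀ (p : A → Bool) {xs : List A} {x} → x ∈ xs → p x ≡ true → any p xs ≡ true
  any-∈ p (here refl) e rewrite e = refl
  any-∈ p {y ∷ xs} (there q) e rewrite any-∈ p q e = ∨-zeroʳ (p y)

∑-swap : {A B : Set} (xs : List A) (ys : List B) (f : A → B → ℕ) →
         ∑ xs (λ x → ∑ ys (f x)) ≡ ∑ ys (λ y → ∑ xs (λ x → f x y))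
∑-swap []       ys f = sym (∑-zero ys)
∑-swap (x ∷ xs) ys f rewrite ∑-swap xs ys f = sym (∑-+ ys (f x) (λ y → ∑ xs (λ x → f x y)))

∑-map : {A B : Set} (g : A → B) (xs : List A) (f : B → ℕ) → ∑ (map g xs) f ≡ ∑ xs (f ∘ g)
∑-map g []       f = refl
∑-map g (x ∷ xs) f = cong (λ t → f (g x) + t) (∑-map g xs f)

∑-concatMap : {A B : Set} (g : A → List B) (xs : List A) (f : B → ℕ) →
              ∑ (concatMap g xs) f ≡ ∑ xs (λ x → ∑ (g x) f)
∑-concatMap g []       f = refl
∑-concatMap g (x ∷ xs) f = trans (∑-++ (g x) _ f) (cong (λ t → ∑ (g x) f + t) (∑-concatMap g xs f))

∑-upTo : ∀ n (f : ℕ → ℕ) → ∑ (upTo (suc n)) f ≡ ∑ (upTo n) f + f n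
∑-upTo n f = begin
  ∑ (upTo (suc n)) f              ≡⟨ cong (λ xs → ∑ xs f) (upTo-∷ʳ n) ⟨
  ∑ (upTo n ++ [ n ]) f           ≡⟨ ∑-++ (upTo n) [ n ] f ⟩
  ∑ (upTo n) f + (f n + 0)        ≡⟨ cong (λ t → ∑ (upTo n) f + t) (+-identityʳ (f n)) ⟩
  ∑ (upTo n) f + f n              ∎
  where open ≡-Reasoning

-- Random sublists and exponential moments

^-mono : ∀ {a b} k → a ≤ b → a ^ k ≤ b ^ k
^-mono k = ^-monoˡ-≤ k

^-distrib-* : ∀ a b k → (a * b) ^ k ≡ a ^ k * b ^ k
^-distrib-* a b zero    = refl
^-distrib-* a b (suc k) rewrite ^-distrib-* a b k = lemma a b (a ^ k) (b ^ k)
  where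
  lemma : ∀ a b c d → a * b * (c * d) ≡ a * c * (b * d)
  lemma = solve-∀

m^n≥1 : ∀ {m} n → 1 ≤ m → 1 ≤ m ^ n
m^n≥1 {m} n h = subst (_≤ m ^ n) (^-zeroˡ n) (^-mono n h)

cancelˡ : ∀ {k a b} → 1 ≤ k → k * a ≤ k * b → a ≤ b
cancelˡ {suc k} _ = *-cancelˡ-≤ (suc k)

-- The random list keeps each entry independently with probability A / (A + B);
-- probabilities are scaled by (A + B)^length to stay in ℕ.
module Expectation (A B : ℕ) {X : Set} where

  𝔼 : List X → (List X → ℕ) → ℕ
  𝔼 []       f = f []
  𝔼 (e ∷ es) f = B * 𝔼 es f + A * 𝔼 es (f ∘ (e ∷_))

  𝔼-mono : ∀ es {f g : List X → ℕ} → (∀ E → f E ≤ g E) → 𝔼 es f ≤ 𝔼 es g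
  𝔼-mono []       h = h []
  𝔼-mono (e ∷ es) h =
    +-mono-≤ (*-monoʳ-≤ B (𝔼-mono es h)) (*-monoʳ-≤ A (𝔼-mono es (h ∘ (e ∷_))))

  𝔼-+ : ∀ es (f g : List X → ℕ) → 𝔼 es (λ E → f E + g E) ≡ 𝔼 es f + 𝔼 es g
  𝔼-+ []       f g = refl
  𝔼-+ (e ∷ es) f g rewrite 𝔼-+ es f g | 𝔼-+ es (f ∘ (e ∷_)) (g ∘ (e ∷_)) =
    lemma A B (𝔼 es f) (𝔼 es g) _ _
    where
    lemma : ∀ A B u v w z → B * (u + v) + A * (w + z) ≡ B * u + A * w + (B * v + A * z)
    lemma = solve-∀

  𝔼-*ˡ : ∀ es c (f : List X → ℕ) → 𝔼 es (λ E → c * f E) ≡ c * 𝔼 es f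
  𝔼-*ˡ []       c f = refl
  𝔼-*ˡ (e ∷ es) c f rewrite 𝔼-*ˡ es c f | 𝔼-*ˡ es c (f ∘ (e ∷_)) =
    lemma A B c (𝔼 es f) _
    where
    lemma : ∀ A B c u v → B * (c * u) + A * (c * v) ≡ c * (B * u + A * v)
    lemma = solve-∀

  𝔼-const : ∀ es c → 𝔼 es (λ _ → c) ≡ (A + B) ^ length es * c
  𝔼-const []       c = sym (+-identityʳ c)
  𝔼-const (e ∷ es) c rewrite 𝔼-const es c = lemma A B ((A + B) ^ length es) c
    where
    lemma : ∀ A B q c → B * (q * c) + A * (q * c) ≡ (A + B) * q * c
    lemma = solve-∀

  𝔼-∑ : ∀ {Y : Set} es (ys : List Y) (f : Y → List X → ℕ) →
        𝔼 es (λ E → ∑ ys (λ y → f y E)) ≡ ∑ ys (λ y → 𝔼 es (f y))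
  𝔼-∑ es []       f = trans (𝔼-const es 0) (*-zeroʳ ((A + B) ^ length es))
  𝔼-∑ es (y ∷ ys) f = trans (𝔼-+ es (f y) _) (cong (λ t → 𝔼 es (f y) + t) (𝔼-∑ es ys f))

  module _ (S : X → Bool) where

    -- The entries are independent, so the moment of x ^ count factorises: an entry outside S
    -- contributes A + B, an entry in S contributes B + A x, and l / k bounds the ratio of B + A x
    -- to A + B.
    exponential-moment : ∀ x k l → k * (B + A * x) ≤ l * (A + B) → ∀ es →
      k ^ ∑ es (𝟙 ∘ S) * 𝔼 es (λ E → x ^ ∑ E (𝟙 ∘ S)) ≤ l ^ ∑ es (𝟙 ∘ S) * (A + B) ^ length es
    exponential-moment x k l h []       = ≤-refl
    exponential-moment x k l h (e ∷ es) with S e | exponential-moment x k l h es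
    ... | false | ih = begin
      K * (B * F + A * F)      ≡⟨ lemma₁ A B K F ⟩
      (A + B) * (K * F)        ≤⟨ *-monoʳ-≤ (A + B) ih ⟩
      (A + B) * (L * Q)        ≡⟨ lemma₂ (A + B) L Q ⟩
      L * ((A + B) * Q)        ∎
      where
      open ≤-Reasoning
      K = k ^ ∑ es (𝟙 ∘ S)
      L = l ^ ∑ es (𝟙 ∘ S)
      F = 𝔼 es (λ E → x ^ ∑ E (𝟙 ∘ S))
      Q = (A + B) ^ length es
      lemma₁ : ∀ A B K F → K * (B * F + A * F) ≡ (A + B) * (K * F)
      lemma₁ = solve-∀
      lemma₂ : ∀ c L Q → c * (L * Q) ≡ L * (c * Q)
      lemma₂ = solve-∀
    ... | true  | ih rewrite 𝔼-*ˡ es x (λ E → x ^ ∑ E (𝟙 ∘ S)) = begin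
      k * K * (B * F + A * (x * F))    ≡⟨ lemma₁ A B x k K F ⟩
      k * (B + A * x) * (K * F)        ≤⟨ *-mono-≤ h ih ⟩
      l * (A + B) * (L * Q)            ≡⟨ lemma₂ l (A + B) L Q ⟩
      l * L * ((A + B) * Q)            ∎
      where
      open ≤-Reasoning
      K = k ^ ∑ es (𝟙 ∘ S)
      L = l ^ ∑ es (𝟙 ∘ S)
      F = 𝔼 es (λ E → x ^ ∑ E (𝟙 ∘ S))
      Q = (A + B) ^ length es
      lemma₁ : ∀ A B x k K F → k * K * (B * F + A * (x * F)) ≡ k * (B + A * x) * (K * F)
      lemma₁ = solve-∀
      lemma₂ : ∀ l c L Q → l * c * (L * Q) ≡ l * L * (c * Q)
      lemma₂ = solve-∀

    -- Markov's inequality for x ^ count. Only an upper bound N on the number of entries in S is at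
    -- hand, so the missing factors l / k, which are at least 1, are padded in; c bounds (l / k) ^
    -- N.
    chernoff : ∀ m x k l N c es →
      1 ≤ x → 1 ≤ k → k ≤ l → k * (B + A * x) ≤ l * (A + B) →
      ∑ es (𝟙 ∘ S) ≤ N → l ^ N ≤ c * k ^ N →
      x ^ m * 𝔼 es (λ E → 𝟙 (m ≤ᵇ ∑ E (𝟙 ∘ S))) ≤ c * (A + B) ^ length es
    chernoff m x k l N c es 1≤x 1≤k k≤l h N₀≤N lN≤ckN = cancelˡ (m^n≥1 N 1≤k) (begin
      k ^ N * (x ^ m * 𝔼 es (λ E → 𝟙 (m ≤ᵇ ∑ E (𝟙 ∘ S))))  ≡⟨ cong (k ^ N *_) (𝔼-*ˡ es (x ^ m) _) ⟨
      k ^ N * 𝔼 es (λ E → x ^ m * 𝟙 (m ≤ᵇ ∑ E (𝟙 ∘ S)))    ≤⟨ *-monoʳ-≤ (k ^ N) (𝔼-mono es (λ E → markov (∑ E (𝟙 ∘ S)))) ⟩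
      k ^ N * F                                             ≡⟨ cong (_* F) (split k) ⟩
      k ^ (N ∸ N₀) * k ^ N₀ * F                             ≡⟨ *-assoc (k ^ (N ∸ N₀)) _ _ ⟩
      k ^ (N ∸ N₀) * (k ^ N₀ * F)                           ≤⟨ *-mono-≤ (^-mono (N ∸ N₀) k≤l) (exponential-moment x k l h es) ⟩
      l ^ (N ∸ N₀) * (l ^ N₀ * Q)                           ≡⟨ *-assoc (l ^ (N ∸ N₀)) _ _ ⟨
      l ^ (N ∸ N₀) * l ^ N₀ * Q                             ≡⟨ cong (_* Q) (split l) ⟨
      l ^ N * Q                                             ≤⟨ *-monoˡ-≤ Q lN≤ckN ⟩
      c * k ^ N * Q                                         ≡⟨ lemma c (k ^ N) Q ⟩
      k ^ N * (c * Q)                                       ∎)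
      where
      open ≤-Reasoning
      N₀ = ∑ es (𝟙 ∘ S)
      F = 𝔼 es (λ E → x ^ ∑ E (𝟙 ∘ S))
      Q = (A + B) ^ length es
      split : ∀ k → k ^ N ≡ k ^ (N ∸ N₀) * k ^ N₀
      split k = trans (cong (k ^_) (sym (m∸n+n≡m N₀≤N))) (^-distribˡ-+-* k (N ∸ N₀) N₀)
      lemma : ∀ c K Q → c * K * Q ≡ K * (c * Q)
      lemma = solve-∀
      markov : ∀ t → x ^ m * 𝟙 (m ≤ᵇ t) ≤ x ^ t
      markov t with m ≤ᵇ t in eq
      ... | false rewrite *-zeroʳ (x ^ m) = z≤n
      ... | true  rewrite *-identityʳ (x ^ m) =
        ^-monoʳ-≤ x {{>-nonZero 1≤x}} (≤ᵇ⇒≤ m t (subst T (sym eq) _))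

∑-sublists : {X : Set} (x : X) (xs : List X) (f : List X → ℕ) →
  ∑ (sublists (x ∷ xs)) f ≡ ∑ (sublists xs) f + ∑ (sublists xs) (f ∘ (x ∷_))
∑-sublists x xs f = trans (∑-++ (sublists xs) _ f) (cong (λ t → ∑ (sublists xs) f + t) (∑-map (x ∷_) (sublists xs) f))

suc-≤ᵇ : ∀ a k → (suc a ≤ᵇ suc k) ≡ (a ≤ᵇ k)
suc-≤ᵇ zero    k = refl
suc-≤ᵇ (suc a) k = refl

-- Weighting a list of length j by (s / n)^j shows that there are at most
-- (1 + s / n)^m (n / s)^k sublists of length ≤ k; here without denominators.
sublists-count : ∀ {X : Set} (xs : List X) {s n} k → s ≤ n →
  s ^ k * ∑ (sublists xs) (λ U → 𝟙 (length U ≤ᵇ k)) * n ^ length xs ≤ (n + s) ^ length xs * n ^ k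
sublists-count [] {s} {n} k s≤n = begin
  s ^ k * 1 * 1  ≡⟨ lemma (s ^ k) ⟩
  s ^ k          ≤⟨ ^-mono k s≤n ⟩
  n ^ k          ≡⟨ +-identityʳ (n ^ k) ⟨
  1 * n ^ k      ∎
  where
  open ≤-Reasoning
  lemma : ∀ a → a * 1 * 1 ≡ a
  lemma = solve-∀
sublists-count (x ∷ xs) {s} {n} zero s≤n
  rewrite ∑-sublists x xs (λ U → 𝟙 (length U ≤ᵇ 0)) | ∑-zero (sublists xs) = begin
  1 * (C + 0) * (n * n ^ m)     ≡⟨ lemma n C (n ^ m) ⟩
  n * (1 * C * n ^ m)           ≤⟨ *-monoʳ-≤ n (sublists-count xs 0 s≤n) ⟩
  n * ((n + s) ^ m * 1)         ≤⟨ *-monoˡ-≤ _ (m≤m+n n s) ⟩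
  (n + s) * ((n + s) ^ m * 1)   ≡⟨ *-assoc (n + s) _ 1 ⟨
  (n + s) * (n + s) ^ m * 1     ∎
  where
  open ≤-Reasoning
  m = length xs
  C = ∑ (sublists xs) (λ U → 𝟙 (length U ≤ᵇ 0))
  lemma : ∀ n C q → 1 * (C + 0) * (n * q) ≡ n * (1 * C * q)
  lemma = solve-∀
sublists-count (x ∷ xs) {s} {n} (suc k) s≤n
  rewrite ∑-sublists x xs (λ U → 𝟙 (length U ≤ᵇ suc k))
        | ∑-cong (sublists xs) (λ U → cong 𝟙 (suc-≤ᵇ (length U) k)) = begin
  -- C₁ counts the sublists without x, C₀ those with x, which spend one unit of the size bound.
  s * s ^ k * (C₁ + C₀) * (n * n ^ m)                           ≡⟨ lemma₁ s (s ^ k) C₁ C₀ n (n ^ m) ⟩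
  n * (s * s ^ k * C₁ * n ^ m) + s * n * (s ^ k * C₀ * n ^ m)   ≤⟨ +-mono-≤ (*-monoʳ-≤ n (sublists-count xs (suc k) s≤n)) (*-monoʳ-≤ (s * n) (sublists-count xs k s≤n)) ⟩
  n * ((n + s) ^ m * (n * n ^ k)) + s * n * ((n + s) ^ m * n ^ k)  ≡⟨ lemma₂ s n ((n + s) ^ m) (n ^ k) ⟩
  (n + s) * (n + s) ^ m * (n * n ^ k)                           ∎
  where
  open ≤-Reasoning
  m = length xs
  C₁ = ∑ (sublists xs) (λ U → 𝟙 (length U ≤ᵇ suc k))
  C₀ = ∑ (sublists xs) (λ U → 𝟙 (length U ≤ᵇ k))
  lemma₁ : ∀ s sk C₁ C₀ n q → s * sk * (C₁ + C₀) * (n * q) ≡ n * (s * sk * C₁ * q) + s * n * (sk * C₀ * q)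
  lemma₁ = solve-∀
  lemma₂ : ∀ s n q nk → n * (q * (n * nk)) + s * n * (q * nk) ≡ (n + s) * q * (n * nk)
  lemma₂ = solve-∀

-- (1 + 1/N)^j (1 - j/N) ≤ 1, in the form N = i + j.
bernoulli : ∀ j i → suc (i + j) ^ j * i ≤ (i + j) ^ suc j
bernoulli zero    i = ≤-reflexive (lemma i)
  where
  lemma : ∀ i → 1 * i ≡ (i + 0) * 1
  lemma = solve-∀
-- One unit moves from j to i while N stays fixed. The step costs (1 + N) i ≤ N (1 + i), which is i
-- ≤ N.
bernoulli (suc j) i rewrite +-suc i j = begin
  suc N * suc N ^ j * i              ≡⟨ lemma₁ N (suc N ^ j) i ⟩
  suc N ^ j * (i * N + i)            ≤⟨ *-monoʳ-≤ (suc N ^ j) (+-monoʳ-≤ (i * N) i≤N) ⟩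
  suc N ^ j * (i * N + N)            ≡⟨ lemma₂ N (suc N ^ j) i ⟩
  N * (suc N ^ j * suc i)            ≤⟨ *-monoʳ-≤ N (bernoulli j (suc i)) ⟩
  N * N ^ suc j                      ∎
  where
  open ≤-Reasoning
  N = suc (i + j)
  i≤N : i ≤ N
  i≤N = ≤-trans (m≤m+n i j) (n≤1+n _)
  lemma₁ : ∀ N q i → (1 + N) * q * i ≡ q * (i * N + i)
  lemma₁ = solve-∀
  lemma₂ : ∀ N q i → q * (i * N + N) ≡ N * (q * (1 + i))
  lemma₂ = solve-∀

-- From 4 m (m + 1) ≤ (2 m + 1)² follows 1 + 1/m ≤ (1 + 1/(2 m))², and `bernoulli` with i = j = m
-- gives (1 + 1/(2 m))^m ≤ 2.
[1+m]^m≤4m^m : ∀ m → suc m ^ m ≤ 4 * m ^ m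
[1+m]^m≤4m^m zero = s≤s z≤n
[1+m]^m≤4m^m m@(suc _) = cancelˡ (m^n≥1 m 1≤4m) (begin
  (4 * m) ^ m * suc m ^ m                    ≡⟨ ^-distrib-* (4 * m) (suc m) m ⟨
  (4 * m * suc m) ^ m                        ≤⟨ ^-mono m (≤-trans (n≤1+n _) (≤-reflexive (lemma₁ m))) ⟩
  (suc (m + m) * suc (m + m)) ^ m            ≡⟨ ^-distrib-* (suc (m + m)) (suc (m + m)) m ⟩
  suc (m + m) ^ m * suc (m + m) ^ m          ≤⟨ *-mono-≤ half half ⟩
  2 * (m + m) ^ m * (2 * (m + m) ^ m)        ≡⟨ lemma₂ ((m + m) ^ m) ⟩
  4 * ((m + m) ^ m * (m + m) ^ m)            ≡⟨ cong (4 *_) (^-distrib-* (m + m) (m + m) m) ⟨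
  4 * ((m + m) * (m + m)) ^ m                ≡⟨ cong (λ t → 4 * t ^ m) (lemma₃ m) ⟩
  4 * (4 * m * m) ^ m                        ≡⟨ cong (4 *_) (^-distrib-* (4 * m) m m) ⟩
  4 * ((4 * m) ^ m * m ^ m)                  ≡⟨ lemma₄ ((4 * m) ^ m) (m ^ m) ⟩
  (4 * m) ^ m * (4 * m ^ m)                  ∎)
  where
  open ≤-Reasoning
  1≤4m : 1 ≤ 4 * m
  1≤4m = s≤s z≤n
  half : suc (m + m) ^ m ≤ 2 * (m + m) ^ m
  half = cancelˡ {m} (s≤s z≤n) (begin
    m * suc (m + m) ^ m      ≡⟨ *-comm m _ ⟩
    suc (m + m) ^ m * m      ≤⟨ bernoulli m m ⟩
    (m + m) * (m + m) ^ m    ≡⟨ lemma m ((m + m) ^ m) ⟩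
    m * (2 * (m + m) ^ m)    ∎)
    where
    lemma : ∀ m q → (m + m) * q ≡ m * (2 * q)
    lemma = solve-∀
  lemma₁ : ∀ m → suc (4 * m * suc m) ≡ suc (m + m) * suc (m + m)
  lemma₁ = solve-∀
  lemma₂ : ∀ q → 2 * q * (2 * q) ≡ 4 * (q * q)
  lemma₂ = solve-∀
  lemma₃ : ∀ m → (m + m) * (m + m) ≡ 4 * m * m
  lemma₃ = solve-∀
  lemma₄ : ∀ p q → 4 * (p * q) ≡ p * (4 * q)
  lemma₄ = solve-∀

-- Each unit of a costs a factor 4: with m = n + a ≥ n, (1 + 1/m)^n ≤ (1 + 1/m)^m ≤ 4.
[n+a]^n≤4^an^n : ∀ n a → (n + a) ^ n ≤ 4 ^ a * n ^ n
[n+a]^n≤4^an^n n zero    rewrite +-identityʳ n | +-identityʳ (n ^ n) = ≤-refl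
[n+a]^n≤4^an^n zero (suc a) = ≤-trans (m^n≥1 (suc a) (s≤s z≤n)) (≤-reflexive (sym (*-identityʳ _)))
[n+a]^n≤4^an^n n@(suc _) (suc a) = begin
  (n + suc a) ^ n        ≡⟨ cong (_^ n) (+-suc n a) ⟩
  suc m ^ n              ≤⟨ cancelˡ (m^n≥1 a (s≤s z≤n)) step ⟩
  4 * m ^ n              ≤⟨ *-monoʳ-≤ 4 ([n+a]^n≤4^an^n n a) ⟩
  4 * (4 ^ a * n ^ n)    ≡⟨ *-assoc 4 (4 ^ a) (n ^ n) ⟨
  4 ^ suc a * n ^ n      ∎
  where
  open ≤-Reasoning
  m = n + a
  lemma : ∀ a b → a * (4 * b) ≡ 4 * (b * a)
  lemma = solve-∀
  step : m ^ a * suc m ^ n ≤ m ^ a * (4 * m ^ n)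
  step = begin
    m ^ a * suc m ^ n        ≤⟨ *-monoˡ-≤ (suc m ^ n) (^-mono a (n≤1+n m)) ⟩
    suc m ^ a * suc m ^ n    ≡⟨ *-comm (suc m ^ a) _ ⟩
    suc m ^ n * suc m ^ a    ≡⟨ ^-distribˡ-+-* (suc m) n a ⟨
    suc m ^ m                ≤⟨ [1+m]^m≤4m^m m ⟩
    4 * m ^ m                ≡⟨ cong (4 *_) (^-distribˡ-+-* m n a) ⟩
    4 * (m ^ n * m ^ a)      ≡⟨ lemma (m ^ a) (m ^ n) ⟨
    m ^ a * (4 * m ^ n)      ∎

-- The two exceptional events and their probabilities

mem : List ℕ → ℕ → Bool
mem U v = any (v ≡ᵇ_) U

both touch : List ℕ → ℕ × ℕ → Bool
both  U (i , j) = mem U i ∧ mem U j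
touch U (i , j) = mem U i ∨ mem U j

-- Absence of repetitions in a list is expressed below as `mult v xs ≤ 1` for all v, a form that
-- combines directly with double sums.
mult : ℕ → List ℕ → ℕ
mult v xs = ∑ xs (λ u → 𝟙 (v ≡ᵇ u))

≡ᵇ-refl : ∀ n → (n ≡ᵇ n) ≡ true
≡ᵇ-refl zero    = refl
≡ᵇ-refl (suc n) = ≡ᵇ-refl n

≡ᵇ-comm : ∀ m n → (m ≡ᵇ n) ≡ (n ≡ᵇ m)
≡ᵇ-comm zero    zero    = refl
≡ᵇ-comm zero    (suc n) = refl
≡ᵇ-comm (suc m) zero    = refl
≡ᵇ-comm (suc m) (suc n) = ≡ᵇ-comm m n

≡ᵇ-true⇒≡ : ∀ m n → (m ≡ᵇ n) ≡ true → m ≡ n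
≡ᵇ-true⇒≡ m n e = ≡ᵇ⇒≡ m n (subst T (sym e) _)

≢⇒≡ᵇ-false : ∀ m n → m ≢ n → (m ≡ᵇ n) ≡ false
≢⇒≡ᵇ-false m n m≢n with m ≡ᵇ n in e
... | false = refl
... | true  = ⊥-elim (m≢n (≡ᵇ-true⇒≡ m n e))

mult-upTo≡0 : ∀ n {v} → n ≤ v → mult v (upTo n) ≡ 0
mult-upTo≡0 zero        _   = refl
mult-upTo≡0 (suc n) {v} n<v
  rewrite ∑-upTo n (λ u → 𝟙 (v ≡ᵇ u)) | mult-upTo≡0 n (<⇒≤ n<v) | ≢⇒≡ᵇ-false v n (>⇒≢ n<v) = refl

mult-upTo≤1 : ∀ n v → mult v (upTo n) ≤ 1
mult-upTo≤1 zero    v = z≤n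
mult-upTo≤1 (suc n) v rewrite ∑-upTo n (λ u → 𝟙 (v ≡ᵇ u)) with v ≡ᵇ n in e
... | false rewrite +-identityʳ (mult v (upTo n)) = mult-upTo≤1 n v
... | true  rewrite mult-upTo≡0 n {v} (≤-reflexive (sym (≡ᵇ-true⇒≡ v n e))) = ≤-refl

∑-mem≤length : ∀ n U → ∑ (upTo n) (𝟙 ∘ mem U) ≤ length U
∑-mem≤length n U = begin
  ∑ (upTo n) (𝟙 ∘ mem U)                             ≤⟨ ∑-mono (upTo n) (λ i → 𝟙-any≤∑ (i ≡ᵇ_) U) ⟩
  ∑ (upTo n) (λ i → ∑ U (λ u → 𝟙 (i ≡ᵇ u)))          ≡⟨ ∑-swap (upTo n) U (λ i u → 𝟙 (i ≡ᵇ u)) ⟩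
  ∑ U (λ u → ∑ (upTo n) (λ i → 𝟙 (i ≡ᵇ u)))          ≡⟨ ∑-cong U (λ u → ∑-cong (upTo n) (λ i → cong 𝟙 (≡ᵇ-comm i u))) ⟩
  ∑ U (λ u → mult u (upTo n))                        ≤⟨ ∑-mono U (mult-upTo≤1 n) ⟩
  ∑ U (λ _ → 1)                                      ≡⟨ length≡∑ U ⟨
  length U                                           ∎
  where open ≤-Reasoning

∑-pairs : ∀ n f → ∑ (pairs n) f ≡ ∑ (upTo n) (λ j → ∑ (upTo j) (λ i → f (i , j)))
∑-pairs n f = trans (∑-concatMap (λ j → map (λ i → i , j) (upTo j)) (upTo n) f)
                    (∑-cong (upTo n) (λ j → ∑-map (λ i → i , j) (upTo j) f))

-- Adding the vertex n creates at most c x new pairs, where x is 0 or 1, and (c + x)² exceeds c² by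
-- at least that. The factor 2 lost against the binomial coefficient only enters the constant in
-- `scale`.
pairs-both-≤ : ∀ n U → ∑ (pairs n) (𝟙 ∘ both U) ≤ length U * length U
pairs-both-≤ n U = ≤-trans (≤-reflexive (∑-pairs n _))
  (≤-trans (go n) (*-mono-≤ (∑-mem≤length n U) (∑-mem≤length n U)))
  where
  open ≤-Reasoning
  c : ℕ → ℕ
  c n = ∑ (upTo n) (𝟙 ∘ mem U)
  lemma : ∀ c x → c * c + c * x + (c * x + x * x) ≡ (c + x) * (c + x)
  lemma = solve-∀
  go : ∀ n → ∑ (upTo n) (λ j → ∑ (upTo j) (λ i → 𝟙 (both U (i , j)))) ≤ c n * c n
  go zero    = z≤n
  go (suc n) rewrite ∑-upTo n (λ j → ∑ (upTo j) (λ i → 𝟙 (both U (i , j)))) | ∑-upTo n (𝟙 ∘ mem U) = begin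
    F + ∑ (upTo n) (λ i → 𝟙 (mem U i ∧ mem U n))     ≡⟨ cong (λ t → F + t) (∑-cong (upTo n) (λ i → 𝟙-∧ (mem U i) (mem U n))) ⟩
    F + ∑ (upTo n) (λ i → 𝟙 (mem U i) * 𝟙 (mem U n)) ≡⟨ cong (λ t → F + t) (∑-*ʳ (upTo n) (𝟙 (mem U n)) (𝟙 ∘ mem U)) ⟩
    F + c n * 𝟙 (mem U n)                            ≤⟨ +-monoˡ-≤ _ (go n) ⟩
    c n * c n + c n * x                              ≤⟨ m≤m+n _ _ ⟩
    c n * c n + c n * x + (c n * x + x * x)          ≡⟨ lemma (c n) x ⟩
    (c n + x) * (c n + x)                            ∎
    where
    x = 𝟙 (mem U n)
    F = ∑ (upTo n) (λ j → ∑ (upTo j) (λ i → 𝟙 (both U (i , j))))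

-- Charging each pair to an endpoint in U leaves at most n possible partners.
pairs-touch-≤ : ∀ n U → ∑ (pairs n) (𝟙 ∘ touch U) ≤ n * length U
pairs-touch-≤ n U = ≤-trans (≤-reflexive (∑-pairs n _))
  (≤-trans (go n) (*-monoʳ-≤ n (∑-mem≤length n U)))
  where
  open ≤-Reasoning
  c : ℕ → ℕ
  c n = ∑ (upTo n) (𝟙 ∘ mem U)
  lemma : ∀ n c x → n * c + (c + n * x) + x ≡ (1 + n) * (c + x)
  lemma = solve-∀
  go : ∀ n → ∑ (upTo n) (λ j → ∑ (upTo j) (λ i → 𝟙 (touch U (i , j)))) ≤ n * c n
  go zero    = z≤n
  go (suc n) rewrite ∑-upTo n (λ j → ∑ (upTo j) (λ i → 𝟙 (touch U (i , j)))) | ∑-upTo n (𝟙 ∘ mem U) = begin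
    F + ∑ (upTo n) (λ i → 𝟙 (mem U i ∨ mem U n))     ≤⟨ +-monoʳ-≤ F (∑-mono (upTo n) (λ i → 𝟙-∨-≤ (mem U i) (mem U n))) ⟩
    F + ∑ (upTo n) (λ i → 𝟙 (mem U i) + x)           ≡⟨ cong (λ t → F + t) (∑-+ (upTo n) (𝟙 ∘ mem U) (λ _ → x)) ⟩
    F + (c n + ∑ (upTo n) (λ _ → x))                 ≡⟨ cong (λ t → F + (c n + t)) (trans (∑-const (upTo n) x) (cong (_* x) (length-upTo n))) ⟩
    F + (c n + n * x)                                ≤⟨ +-monoˡ-≤ _ (go n) ⟩
    n * c n + (c n + n * x)                          ≤⟨ m≤m+n _ x ⟩
    n * c n + (c n + n * x) + x                      ≡⟨ lemma n (c n) x ⟩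
    suc n * (c n + x)                                ∎
    where
    x = 𝟙 (mem U n)
    F = ∑ (upTo n) (λ j → ∑ (upTo j) (λ i → 𝟙 (touch U (i , j))))

smallSets : ℕ → ℕ → ℕ
smallSets n k = ∑ (sublists (upTo n)) (λ U → 𝟙 (length U ≤ᵇ k))

-- The weighted count of sublists, with (1 + s / n)^n ≤ 4^s. The weight parameter s is independent
-- of k, so the same s serves for the choices of R (k = s) and of W (k = 2 s).
smallSets-≤ : ∀ {n s} k → 1 ≤ n → s ≤ n → s ^ k * smallSets n k ≤ 4 ^ s * n ^ k
smallSets-≤ {n} {s} k 1≤n s≤n = cancelˡ (m^n≥1 n 1≤n) (begin
  n ^ n * (s ^ k * smallSets n k)              ≡⟨ *-comm (n ^ n) _ ⟩
  s ^ k * smallSets n k * n ^ n                ≡⟨ cong (λ m → s ^ k * smallSets n k * n ^ m) (length-upTo n) ⟨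
  s ^ k * smallSets n k * n ^ length (upTo n)  ≤⟨ sublists-count (upTo n) k s≤n ⟩
  (n + s) ^ length (upTo n) * n ^ k            ≡⟨ cong (λ m → (n + s) ^ m * n ^ k) (length-upTo n) ⟩
  (n + s) ^ n * n ^ k                          ≤⟨ *-monoˡ-≤ (n ^ k) ([n+a]^n≤4^an^n n s) ⟩
  4 ^ s * n ^ n * n ^ k                        ≡⟨ lemma (4 ^ s) (n ^ n) (n ^ k) ⟩
  n ^ n * (4 ^ s * n ^ k)                      ∎)
  where
  open ≤-Reasoning
  lemma : ∀ a b c → a * b * c ≡ b * (a * c)
  lemma = solve-∀

-- Constants and decay rates.

n≤2^n : ∀ n → n ≤ 2 ^ n
n≤2^n zero    = z≤n
n≤2^n (suc n) = begin
  1 + n              ≤⟨ +-mono-≤ (m^n≥1 {2} n (s≤s z≤n)) (n≤2^n n) ⟩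
  2 ^ n + 2 ^ n      ≡⟨ cong (λ t → 2 ^ n + t) (+-identityʳ _) ⟨
  2 ^ suc n          ∎
  where open ≤-Reasoning

4^n≡2^n*2^n : ∀ n → 4 ^ n ≡ 2 ^ n * 2 ^ n
4^n≡2^n*2^n = ^-distrib-* 2 2

-- The constant M: here (16 D ^ 4) ^ s bounds n ^ (4 s) / (x s) ^ (4 s) for
-- x = ⌊n / (D s)⌋, the factors 4 ^ s come from counting R and W, and 4 ^ (9 s)
-- from the exponential moment of the number of edges inside R ∪ W.
scale : ℕ → ℕ
scale D = 4 * (16 * D ^ 4 * 4 * 4 * 4 ^ 9)

D≤scale : ∀ D → 1 ≤ D → D ≤ scale D
D≤scale D 1≤D = begin
  D                              ≡⟨ ^-identityʳ D ⟨
  D ^ 1                          ≤⟨ ^-monoʳ-≤ D {{>-nonZero 1≤D}} (s≤s {0} {3} z≤n) ⟩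
  D ^ 4                          ≤⟨ m≤n*m (D ^ 4) 16 ⟩
  16 * D ^ 4                     ≤⟨ m≤m*n _ 4 ⟩
  16 * D ^ 4 * 4                 ≤⟨ m≤m*n _ 4 ⟩
  16 * D ^ 4 * 4 * 4             ≤⟨ m≤m*n _ (4 ^ 9) ⟩
  16 * D ^ 4 * 4 * 4 * 4 ^ 9     ≤⟨ m≤n*m _ 4 ⟩
  scale D                        ∎
  where open ≤-Reasoning

-- Used with m = D s: the tilt x must be a natural number, and rounding n / m down loses a factor of
-- at most 2. Its fourth power is the 16 in `scale`.
quotient-bounds : ∀ {n m} → 1 ≤ n → 1 ≤ m → m ≤ n →
  Σ ℕ λ x → 1 ≤ x × x * m ≤ n × n ≤ 2 * (x * m)
quotient-bounds {n} {m@(suc _)} 1≤n 1≤m m≤n = x , 1≤x , m/n*n≤m n m , (begin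
  n                  ≡⟨ m≡m%n+[m/n]*n n m ⟩
  n % m + x * m      ≤⟨ +-monoˡ-≤ (x * m) (≤-trans (<⇒≤ (m%n<n n m)) (m≤n*m m x {{>-nonZero 1≤x}})) ⟩
  x * m + x * m      ≡⟨ cong (λ t → x * m + t) (+-identityʳ _) ⟨
  2 * (x * m)        ∎)
  where
  open ≤-Reasoning
  x = n / m
  1≤x : 1 ≤ x
  1≤x = m≥n⇒m/n>0 m≤n

-- Here P / T is at most (K s / n)^s. Multiplied by 4^s this is a product of s factors 4 K s / n ≤
-- 1, one of which is kept to produce the 1 / n. Of 4^s, one 2^s absorbs s and the other is the
-- claimed decay.
geometric-decay : ∀ {n} K {T P} s → 1 ≤ s → 1 ≤ n → 4 * K * s ≤ n → n ^ s * P ≤ (K * s) ^ s * T →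
  2 ^ s * (n * P) ≤ 4 * K * T
geometric-decay {n} K {T} {P} s@(suc t) 1≤s 1≤n Ms≤n h = cancelˡ (m^n≥1 {2} s (s≤s z≤n)) (begin
  2 ^ s * (2 ^ s * (n * P))          ≡⟨ *-assoc (2 ^ s) _ _ ⟨
  2 ^ s * 2 ^ s * (n * P)            ≡⟨ cong (_* (n * P)) (4^n≡2^n*2^n s) ⟨
  4 ^ s * (n * P)                    ≤⟨ cancelˡ (m^n≥1 t 1≤n) (begin
    n ^ t * (4 ^ s * (n * P))            ≡⟨ e₁ (n ^ t) (4 ^ s) n P ⟩
    4 ^ s * (n ^ s * P)                  ≤⟨ *-monoʳ-≤ (4 ^ s) h ⟩
    4 ^ s * ((K * s) ^ s * T)            ≡⟨ *-assoc (4 ^ s) _ T ⟨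
    4 ^ s * (K * s) ^ s * T              ≡⟨ cong (_* T) (^-distrib-* 4 (K * s) s) ⟨
    (4 * (K * s)) ^ s * T                ≡⟨ cong (λ a → a ^ s * T) (*-assoc 4 K s) ⟨
    (4 * K * s) ^ s * T                  ≡⟨ e₂ (4 * K * s) ((4 * K * s) ^ t) T ⟩
    (4 * K * s) ^ t * (4 * K * s * T)    ≤⟨ *-monoˡ-≤ _ (^-mono t Ms≤n) ⟩
    n ^ t * (4 * K * s * T)              ∎) ⟩
  4 * K * s * T                      ≤⟨ *-monoˡ-≤ T (*-monoʳ-≤ (4 * K) (n≤2^n s)) ⟩
  4 * K * 2 ^ s * T                  ≡⟨ e₂ (4 * K) (2 ^ s) T ⟩
  2 ^ s * (4 * K * T)                ∎)
  where
  open ≤-Reasoning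
  e₁ : ∀ u f n P → u * (f * (n * P)) ≡ f * (n * u * P)
  e₁ = solve-∀
  e₂ : ∀ a u T → a * u * T ≡ u * (a * T)
  e₂ = solve-∀
  e₃ : ∀ a u T → a * u * T ≡ u * (a * T)
  e₃ = solve-∀

-- The number of witnesses (R, W) instead of the indicator of their existence, so that linearity of
-- expectation performs the union bound. The same holds for `touchEvent`.
denseEvent : ℕ → ℕ → Graph → ℕ
denseEvent n s E =
  ∑ (sublists (upTo n)) λ R → ∑ (sublists (upTo n)) λ W →
    𝟙 (length R ≤ᵇ s) * (𝟙 (length W ≤ᵇ s + s) * 𝟙 (4 * s ≤ᵇ ∑ E (𝟙 ∘ both (R ++ W))))

touchEvent : ℕ → ℕ → ℕ → Graph → ℕ
touchEvent n D s E =
  ∑ (sublists (upTo n)) λ R → 𝟙 (length R ≤ᵇ s) * 𝟙 (7 * D * s ≤ᵇ ∑ E (𝟙 ∘ touch R))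

-- The last hypothesis says that the edge probability A / (A + B) is at most D / n.
module Bounds (n D A B : ℕ) (1≤n : 1 ≤ n) (1≤D : 1 ≤ D) (An≤DQ : A * n ≤ D * (A + B)) where

  open Expectation A B

  private
    V : List ℕ
    V = upTo n

    tot : ℕ
    tot = (A + B) ^ length (pairs n)

  -- Tilting edges by x ≈ n / (D s) multiplies the expected weight of each of the
  -- at most (3 s)² pairs by at most 1 + 1 / s.
  dense-chernoff : ∀ s x U → 1 ≤ s → 1 ≤ x → x * (D * s) ≤ n → length U ≤ 3 * s →
    x ^ (4 * s) * 𝔼 (pairs n) (λ E → 𝟙 (4 * s ≤ᵇ ∑ E (𝟙 ∘ both U))) ≤ 4 ^ (9 * s) * tot
  dense-chernoff s x U 1≤s 1≤x xDs≤n |U|≤3s =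
    chernoff (both U) (4 * s) x s (suc s) (s * (9 * s)) (4 ^ (9 * s)) (pairs n)
      1≤x 1≤s (n≤1+n s) tilt
      (≤-trans (pairs-both-≤ n U) (≤-trans (*-mono-≤ |U|≤3s |U|≤3s) (≤-reflexive (lemma₀ s))))
      (begin
        -- The exponent 9 s² is kept as s times 9 s so that (1 + 1/s)^s ≤ 4 applies 9 s times.
        suc s ^ (s * (9 * s))                 ≡⟨ ^-*-assoc (suc s) s (9 * s) ⟨
        (suc s ^ s) ^ (9 * s)                 ≤⟨ ^-mono (9 * s) ([1+m]^m≤4m^m s) ⟩
        (4 * s ^ s) ^ (9 * s)                 ≡⟨ ^-distrib-* 4 (s ^ s) (9 * s) ⟩
        4 ^ (9 * s) * (s ^ s) ^ (9 * s)       ≡⟨ cong (4 ^ (9 * s) *_) (^-*-assoc s s (9 * s)) ⟩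
        4 ^ (9 * s) * s ^ (s * (9 * s))       ∎)
    where
    open ≤-Reasoning
    lemma₀ : ∀ s → 3 * s * (3 * s) ≡ s * (9 * s)
    lemma₀ = solve-∀
    lemma₁ : ∀ n s A x → n * (s * (A * x)) ≡ A * n * (s * x)
    lemma₁ = solve-∀
    lemma₂ : ∀ D Q s x → D * Q * (s * x) ≡ x * (D * s) * Q
    lemma₂ = solve-∀
    sAx≤Q : s * (A * x) ≤ A + B
    sAx≤Q = cancelˡ 1≤n (begin
      n * (s * (A * x))          ≡⟨ lemma₁ n s A x ⟩
      A * n * (s * x)            ≤⟨ *-monoˡ-≤ (s * x) An≤DQ ⟩
      D * (A + B) * (s * x)      ≡⟨ lemma₂ D (A + B) s x ⟩
      x * (D * s) * (A + B)      ≤⟨ *-monoˡ-≤ (A + B) xDs≤n ⟩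
      n * (A + B)                ∎)
    tilt : s * (B + A * x) ≤ suc s * (A + B)
    tilt = begin
      s * (B + A * x)            ≡⟨ *-distribˡ-+ s B (A * x) ⟩
      s * B + s * (A * x)        ≤⟨ +-mono-≤ (*-monoʳ-≤ s (m≤n+m B A)) sAx≤Q ⟩
      s * (A + B) + (A + B)      ≡⟨ +-comm (s * (A + B)) _ ⟩
      suc s * (A + B)            ∎

  -- Linearity over the pairs (R, W): `dense-chernoff` bounds the terms that satisfy both size
  -- conditions, and the others vanish.
  𝔼-denseEvent : ∀ s x → 1 ≤ s → 1 ≤ x → x * (D * s) ≤ n →
    x ^ (4 * s) * 𝔼 (pairs n) (denseEvent n s) ≤ smallSets n s * (smallSets n (s + s) * (4 ^ (9 * s) * tot))
  𝔼-denseEvent s x 1≤s 1≤x xDs≤n = begin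
    X * 𝔼 ps (denseEvent n s)
      ≡⟨ cong (X *_) (trans (𝔼-∑ ps (sublists V) (λ R E → ∑ (sublists V) λ W → term R W E))
           (∑-cong (sublists V) λ R → 𝔼-∑ ps (sublists V) (term R))) ⟩
    X * ∑ (sublists V) (λ R → ∑ (sublists V) λ W → 𝔼 ps (term R W))
      ≡⟨ trans (sym (∑-*ˡ (sublists V) X _)) (∑-cong (sublists V) λ R → sym (∑-*ˡ (sublists V) X _)) ⟩
    ∑ (sublists V) (λ R → ∑ (sublists V) λ W → X * 𝔼 ps (term R W))
      ≤⟨ ∑-mono (sublists V) (λ R → ∑-mono (sublists V) λ W → bound R W) ⟩
    ∑ (sublists V) (λ R → ∑ (sublists V) λ W → 𝟙 (length R ≤ᵇ s) * (𝟙 (length W ≤ᵇ s + s) * C))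
      ≡⟨ ∑-cong (sublists V) (λ R → trans (∑-*ˡ (sublists V) (𝟙 (length R ≤ᵇ s)) _)
           (cong (𝟙 (length R ≤ᵇ s) *_) (∑-*ʳ (sublists V) C _))) ⟩
    ∑ (sublists V) (λ R → 𝟙 (length R ≤ᵇ s) * (smallSets n (s + s) * C))
      ≡⟨ ∑-*ʳ (sublists V) (smallSets n (s + s) * C) _ ⟩
    smallSets n s * (smallSets n (s + s) * C) ∎
    where
    open ≤-Reasoning
    ps = pairs n
    X = x ^ (4 * s)
    C = 4 ^ (9 * s) * tot
    term : List ℕ → List ℕ → Graph → ℕ
    term R W E = 𝟙 (length R ≤ᵇ s) * (𝟙 (length W ≤ᵇ s + s) * 𝟙 (4 * s ≤ᵇ ∑ E (𝟙 ∘ both (R ++ W))))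
    |R++W| : ∀ R W → length R ≤ s → length W ≤ s + s → length (R ++ W) ≤ 3 * s
    |R++W| R W p q rewrite length-++ R {W} =
      ≤-trans (+-mono-≤ p q) (≤-reflexive (cong (λ t → s + t) (cong (λ t → s + t) (sym (+-identityʳ s)))))
    bound : ∀ R W → X * 𝔼 ps (term R W) ≤ 𝟙 (length R ≤ᵇ s) * (𝟙 (length W ≤ᵇ s + s) * C)
    bound R W with length R ≤ᵇ s in eR | length W ≤ᵇ s + s in eW
    ... | false | _     rewrite 𝔼-const ps 0 | *-zeroʳ ((A + B) ^ length ps) | *-zeroʳ X = z≤n
    ... | true  | false rewrite 𝔼-const ps 0 | *-zeroʳ ((A + B) ^ length ps) | *-zeroʳ X = z≤n
    ... | true  | true  = begin
      X * 𝔼 ps (λ E → 1 * (1 * ind E))  ≡⟨ cong (X *_) (trans (𝔼-*ˡ ps 1 (λ E → 1 * ind E)) (trans (*-identityˡ _) (trans (𝔼-*ˡ ps 1 ind) (*-identityˡ _)))) ⟩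
      X * 𝔼 ps ind                      ≤⟨ dense-chernoff s x (R ++ W) 1≤s 1≤x xDs≤n
                                             (|R++W| R W (≤ᵇ⇒≤ _ _ (subst T (sym eR) _)) (≤ᵇ⇒≤ _ _ (subst T (sym eW) _))) ⟩
      C                                 ≡⟨ trans (*-identityˡ _) (*-identityˡ _) ⟨
      1 * (1 * C)                       ∎
      where
      ind : Graph → ℕ
      ind E = 𝟙 (4 * s ≤ᵇ ∑ E (𝟙 ∘ both (R ++ W)))

  -- The Chernoff bound with x = 2: each of the at most n s pairs touching R contributes a factor of
  -- at most 1 + D / n, and (1 + D / n)^(n s) ≤ 4^(D s).
  𝔼-touchEvent : ∀ s →
    2 ^ (7 * D * s) * 𝔼 (pairs n) (touchEvent n D s) ≤ smallSets n s * (4 ^ (D * s) * tot)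
  𝔼-touchEvent s = begin
    X * 𝔼 ps (touchEvent n D s)
      ≡⟨ cong (X *_) (𝔼-∑ ps (sublists V) term) ⟩
    X * ∑ (sublists V) (λ R → 𝔼 ps (term R))
      ≡⟨ sym (∑-*ˡ (sublists V) X _) ⟩
    ∑ (sublists V) (λ R → X * 𝔼 ps (term R))
      ≤⟨ ∑-mono (sublists V) bound ⟩
    ∑ (sublists V) (λ R → 𝟙 (length R ≤ᵇ s) * C)
      ≡⟨ ∑-*ʳ (sublists V) C _ ⟩
    smallSets n s * C ∎
    where
    open ≤-Reasoning
    ps = pairs n
    X = 2 ^ (7 * D * s)
    C = 4 ^ (D * s) * tot
    term : List ℕ → Graph → ℕ
    term R E = 𝟙 (length R ≤ᵇ s) * 𝟙 (7 * D * s ≤ᵇ ∑ E (𝟙 ∘ touch R))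
    lemma₁ : ∀ n A B → n * (B + A * 2) ≡ n * (A + B) + A * n
    lemma₁ = solve-∀
    tilt : n * (B + A * 2) ≤ (n + D) * (A + B)
    tilt = begin
      n * (B + A * 2)                ≡⟨ lemma₁ n A B ⟩
      n * (A + B) + A * n            ≤⟨ +-monoʳ-≤ (n * (A + B)) An≤DQ ⟩
      n * (A + B) + D * (A + B)      ≡⟨ *-distribʳ-+ (A + B) n D ⟨
      (n + D) * (A + B)              ∎
    bound : ∀ R → X * 𝔼 ps (term R) ≤ 𝟙 (length R ≤ᵇ s) * C
    bound R with length R ≤ᵇ s in eR
    ... | false rewrite 𝔼-const ps 0 | *-zeroʳ ((A + B) ^ length ps) | *-zeroʳ X = z≤n
    ... | true  = begin
      X * 𝔼 ps (λ E → 1 * ind E)        ≡⟨ cong (X *_) (trans (𝔼-*ˡ ps 1 ind) (*-identityˡ _)) ⟩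
      X * 𝔼 ps ind                      ≤⟨ chernoff (touch R) (7 * D * s) 2 n (n + D) (n * s) (4 ^ (D * s)) ps
                                             (s≤s z≤n) 1≤n (m≤m+n n D) tilt
                                             (≤-trans (pairs-touch-≤ n R) (*-monoʳ-≤ n (≤ᵇ⇒≤ _ _ (subst T (sym eR) _))))
                                             growth ⟩
      C                                 ≡⟨ *-identityˡ _ ⟨
      1 * C                             ∎
      where
      ind : Graph → ℕ
      ind E = 𝟙 (7 * D * s ≤ᵇ ∑ E (𝟙 ∘ touch R))
      growth : (n + D) ^ (n * s) ≤ 4 ^ (D * s) * n ^ (n * s)
      growth = begin
        (n + D) ^ (n * s)              ≡⟨ ^-*-assoc (n + D) n s ⟨
        ((n + D) ^ n) ^ s              ≤⟨ ^-mono s ([n+a]^n≤4^an^n n D) ⟩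
        (4 ^ D * n ^ n) ^ s            ≡⟨ ^-distrib-* (4 ^ D) (n ^ n) s ⟩
        (4 ^ D) ^ s * (n ^ n) ^ s      ≡⟨ cong₂ _*_ (^-*-assoc 4 D s) (^-*-assoc n n s) ⟩
        4 ^ (D * s) * n ^ (n * s)      ∎

  -- Up to factors constant^s there are (n / s)^(3 s) choices of R and W, each with probability (D s
  -- / n)^(4 s). The surplus of 4 s edges over 3 s vertices leaves (K s / n)^s, with 4 K =
  -- `scale D`.
  denseEvent-unlikely : ∀ s → 1 ≤ s → scale D * s ≤ n →
    2 ^ s * (n * 𝔼 (pairs n) (denseEvent n s)) ≤ scale D * tot
  denseEvent-unlikely s 1≤s Ms≤n with quotient-bounds 1≤n (*-mono-≤ 1≤D 1≤s) (≤-trans (*-monoˡ-≤ s (D≤scale D 1≤D)) Ms≤n)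
  ... | x , 1≤x , xDs≤n , n≤2xDs =
    geometric-decay (16 * D ^ 4 * 4 * 4 * 4 ^ 9) s 1≤s 1≤n Ms≤n
      (≤-trans (combine (4 ^ s) (n ^ s) (s ^ s) (x ^ (4 * s)) (4 ^ (9 * s)) d tot
                  (𝔼-denseEvent s x 1≤s 1≤x xDs≤n)
                  (smallSets-≤ s 1≤n s≤n)
                  (subst₂ (λ u v → u * smallSets n (s + s) ≤ 4 ^ s * v)
                    (^-distribˡ-+-* s s s) (^-distribˡ-+-* n s s) (smallSets-≤ (s + s) 1≤n s≤n))
                  fourth-power)
        (≤-reflexive (cong (_* tot) collect)))
    where
    open ≤-Reasoning
    d = (16 * D ^ 4) ^ s
    s≤n : s ≤ n
    s≤n = ≤-trans (m≤n*m s (scale D) {{>-nonZero (≤-trans 1≤D (D≤scale D 1≤D))}}) Ms≤n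
    -- Arithmetic with q = 4^s, y = n^s, z = s^s, a = x^(4 s), and N₁, N₂ the numbers of choices of
    -- R and W. Three of the four factors y cancel against N₁ N₂, and the fourth survives.
    combine : ∀ q y z a c d T {N₁ N₂ P} → a * P ≤ N₁ * (N₂ * (c * T)) → z * N₁ ≤ q * y →
      z * z * N₂ ≤ q * (y * y) → y * y * y * y ≤ d * (a * (z * z * z * z)) →
      y * P ≤ d * q * q * c * z * T
    combine q y z a c d T {N₁} {N₂} {P} h₁ h₂ h₃ h₄ with y in eq
    ... | zero  = z≤n
    ... | y′@(suc _) = cancelˡ {y′ * y′ * y′} (s≤s z≤n) (begin
      y′ * y′ * y′ * (y′ * P)                          ≡⟨ e₁ y′ P ⟩
      y′ * y′ * y′ * y′ * P                            ≤⟨ *-monoˡ-≤ P h₄ ⟩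
      d * (a * (z * z * z * z)) * P                    ≡⟨ e₂ d a z P ⟩
      d * (z * z * z * z) * (a * P)                    ≤⟨ *-monoʳ-≤ (d * (z * z * z * z)) h₁ ⟩
      d * (z * z * z * z) * (N₁ * (N₂ * (c * T)))      ≡⟨ e₃ d z N₁ N₂ (c * T) ⟩
      d * z * (c * T) * (z * N₁ * (z * z * N₂))        ≤⟨ *-monoʳ-≤ (d * z * (c * T)) (*-mono-≤ h₂ h₃) ⟩
      d * z * (c * T) * (q * y′ * (q * (y′ * y′)))     ≡⟨ e₄ d z c T q y′ ⟩
      y′ * y′ * y′ * (d * q * q * c * z * T)           ∎)
      where
      e₁ : ∀ y P → y * y * y * (y * P) ≡ y * y * y * y * P
      e₁ = solve-∀
      e₂ : ∀ d a z P → d * (a * (z * z * z * z)) * P ≡ d * (z * z * z * z) * (a * P)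
      e₂ = solve-∀
      e₃ : ∀ d z N₁ N₂ t → d * (z * z * z * z) * (N₁ * (N₂ * t)) ≡ d * z * t * (z * N₁ * (z * z * N₂))
      e₃ = solve-∀
      e₄ : ∀ d z c T q y → d * z * (c * T) * (q * y * (q * (y * y))) ≡ y * y * y * (d * q * q * c * z * T)
      e₄ = solve-∀
    collect : d * 4 ^ s * 4 ^ s * 4 ^ (9 * s) * s ^ s ≡ (16 * D ^ 4 * 4 * 4 * 4 ^ 9 * s) ^ s
    collect = sym (begin-equality
      (16 * D ^ 4 * 4 * 4 * 4 ^ 9 * s) ^ s           ≡⟨ ^-distrib-* (16 * D ^ 4 * 4 * 4 * 4 ^ 9) s s ⟩
      (16 * D ^ 4 * 4 * 4 * 4 ^ 9) ^ s * s ^ s       ≡⟨ cong (_* s ^ s) (^-distrib-* (16 * D ^ 4 * 4 * 4) (4 ^ 9) s) ⟩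
      (16 * D ^ 4 * 4 * 4) ^ s * (4 ^ 9) ^ s * s ^ s ≡⟨ cong₂ (λ u v → u * v * s ^ s) (trans (^-distrib-* (16 * D ^ 4 * 4) 4 s) (cong (_* 4 ^ s) (^-distrib-* (16 * D ^ 4) 4 s))) (^-*-assoc 4 9 s) ⟩
      d * 4 ^ s * 4 ^ s * 4 ^ (9 * s) * s ^ s        ∎)
    to-fourth : ∀ a → a * (a * (a * (a * 1))) ≡ a * a * a * a
    to-fourth = solve-∀
    fourth : ∀ a → a ^ s * a ^ s * a ^ s * a ^ s ≡ (a ^ 4) ^ s
    fourth a = begin-equality
      a ^ s * a ^ s * a ^ s * a ^ s     ≡⟨ to-fourth (a ^ s) ⟨
      (a ^ s) ^ 4                       ≡⟨ ^-*-assoc a s 4 ⟩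
      a ^ (s * 4)                       ≡⟨ cong (a ^_) (*-comm s 4) ⟩
      a ^ (4 * s)                       ≡⟨ ^-*-assoc a 4 s ⟨
      (a ^ 4) ^ s                       ∎
    expand : ∀ x D s →
        2 * (x * (D * s)) * (2 * (x * (D * s)) * (2 * (x * (D * s)) * (2 * (x * (D * s)) * 1))) ≡
        16 * (D * (D * (D * (D * 1)))) * (x * (x * (x * (x * 1))) * (s * (s * (s * (s * 1)))))
    expand = solve-∀
    fourth-power : n ^ s * n ^ s * n ^ s * n ^ s ≤ d * (x ^ (4 * s) * (s ^ s * s ^ s * s ^ s * s ^ s))
    fourth-power = begin
      n ^ s * n ^ s * n ^ s * n ^ s                  ≡⟨ fourth n ⟩
      (n ^ 4) ^ s                                    ≤⟨ ^-mono s (^-mono 4 n≤2xDs) ⟩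
      ((2 * (x * (D * s))) ^ 4) ^ s                  ≡⟨ cong (_^ s) (expand x D s) ⟩
      (16 * D ^ 4 * (x ^ 4 * s ^ 4)) ^ s             ≡⟨ ^-distrib-* (16 * D ^ 4) (x ^ 4 * s ^ 4) s ⟩
      d * (x ^ 4 * s ^ 4) ^ s                        ≡⟨ cong (d *_) (^-distrib-* (x ^ 4) (s ^ 4) s) ⟩
      d * ((x ^ 4) ^ s * (s ^ 4) ^ s)                ≡⟨ cong₂ (λ u v → d * (u * v)) (^-*-assoc x 4 s) (sym (fourth s)) ⟩
      d * (x ^ (4 * s) * (s ^ s * s ^ s * s ^ s * s ^ s)) ∎

  -- Since n ≤ M s for M = `scale D`, there are at most (4 M)^s sets R, each with probability at
  -- most (4^D / 2^(7 D))^s. The last hypothesis makes the product at most 4^(-s): one 2^(-s) is the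
  -- decay in the bound, the other pays for n ≤ M s ≤ M 2^s.
  touchEvent-unlikely : ∀ s → 1 ≤ s → s ≤ n → n ≤ scale D * s → 4 * scale D * 4 * 4 ^ D ≤ 2 ^ (7 * D) →
    2 ^ s * (n * 𝔼 (pairs n) (touchEvent n D s)) ≤ scale D * tot
  touchEvent-unlikely s 1≤s s≤n n≤Ms 16M4^D≤2^7D = begin
    2 ^ s * (n * P)                ≤⟨ *-monoʳ-≤ (2 ^ s) (*-monoˡ-≤ P n≤Ms) ⟩
    2 ^ s * (M * s * P)            ≤⟨ *-monoʳ-≤ (2 ^ s) (*-monoˡ-≤ P (*-monoʳ-≤ M (n≤2^n s))) ⟩
    2 ^ s * (M * 2 ^ s * P)        ≡⟨ e₁ (2 ^ s) M P ⟩
    M * (2 ^ s * 2 ^ s * P)        ≡⟨ cong (λ t → M * (t * P)) (4^n≡2^n*2^n s) ⟨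
    M * (4 ^ s * P)                ≤⟨ *-monoʳ-≤ M (cancelˡ (m^n≥1 s 1≤C) (begin
      C ^ s * (4 ^ s * P)              ≡⟨ *-assoc (C ^ s) (4 ^ s) P ⟨
      C ^ s * 4 ^ s * P                ≡⟨ cong (_* P) (^-distrib-* C 4 s) ⟨
      (C * 4) ^ s * P                  ≤⟨ *-monoˡ-≤ P (^-mono s (≤-trans (≤-reflexive (e₂ (4 * M) (4 ^ D))) 16M4^D≤2^7D)) ⟩
      (2 ^ (7 * D)) ^ s * P            ≡⟨ cong (_* P) (^-*-assoc 2 (7 * D) s) ⟩
      2 ^ (7 * D * s) * P              ≤⟨ cancelˡ (m^n≥1 s 1≤s) (begin
        s ^ s * (2 ^ (7 * D * s) * P)                          ≤⟨ *-monoʳ-≤ (s ^ s) (𝔼-touchEvent s) ⟩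
        s ^ s * (smallSets n s * (4 ^ (D * s) * tot))          ≡⟨ *-assoc (s ^ s) _ _ ⟨
        s ^ s * smallSets n s * (4 ^ (D * s) * tot)            ≤⟨ *-monoˡ-≤ _ (smallSets-≤ s 1≤n s≤n) ⟩
        4 ^ s * n ^ s * (4 ^ (D * s) * tot)                    ≤⟨ *-monoˡ-≤ _ (*-monoʳ-≤ (4 ^ s) (^-mono s n≤Ms)) ⟩
        4 ^ s * (M * s) ^ s * (4 ^ (D * s) * tot)              ≡⟨ cong (λ t → 4 ^ s * t * (4 ^ (D * s) * tot)) (^-distrib-* M s s) ⟩
        4 ^ s * (M ^ s * s ^ s) * (4 ^ (D * s) * tot)          ≡⟨ e₃ (4 ^ s) (M ^ s) (s ^ s) (4 ^ (D * s)) tot ⟩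
        s ^ s * (4 ^ s * M ^ s * 4 ^ (D * s) * tot)            ∎) ⟩
      4 ^ s * M ^ s * 4 ^ (D * s) * tot          ≡⟨ cong₂ (λ u v → u * v * tot) (^-distrib-* 4 M s) (^-*-assoc 4 D s) ⟨
      (4 * M) ^ s * (4 ^ D) ^ s * tot            ≡⟨ cong (_* tot) (^-distrib-* (4 * M) (4 ^ D) s) ⟨
      C ^ s * tot                                ∎)) ⟩
    M * tot                        ∎
    where
    open ≤-Reasoning
    M = scale D
    C = 4 * M * 4 ^ D
    P = 𝔼 (pairs n) (touchEvent n D s)
    1≤C : 1 ≤ C
    1≤C = *-mono-≤ (*-mono-≤ {1} {4} (s≤s z≤n) (≤-trans 1≤D (D≤scale D 1≤D))) (m^n≥1 D (s≤s z≤n))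
    e₁ : ∀ a M P → a * (M * a * P) ≡ M * (a * a * P)
    e₁ = solve-∀
    e₂ : ∀ a b → a * b * 4 ≡ a * 4 * b
    e₂ = solve-∀
    e₃ : ∀ q m z c T → q * (m * z) * (c * T) ≡ z * (q * m * c * T)
    e₃ = solve-∀

-- Vertex sets without a removable vertex

mult≤𝟙-mem : ∀ v xs → mult v xs ≤ 1 → mult v xs ≤ 𝟙 (mem xs v)
mult≤𝟙-mem v []       h = z≤n
mult≤𝟙-mem v (x ∷ xs) h with v ≡ᵇ x
... | true  = h
... | false = mult≤𝟙-mem v xs h

∈⇒mem : ∀ {v xs} → v ∈ xs → mem xs v ≡ true
∈⇒mem {v} p = any-∈ (v ≡ᵇ_) p (≡ᵇ-refl v)

mem-↭ : ∀ {xs ys} v → xs ↭ ys → mem xs v ≡ mem ys v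
mem-↭ v Perm.refl         = refl
mem-↭ v (Perm.prep x p)   = cong ((v ≡ᵇ x) ∨_) (mem-↭ v p)
mem-↭ v (Perm.swap x y p) rewrite mem-↭ v p with v ≡ᵇ x | v ≡ᵇ y
... | true  | true  = refl
... | true  | false = refl
... | false | _     = refl
mem-↭ v (Perm.trans p q)  = trans (mem-↭ v p) (mem-↭ v q)

∑-mem≤∑ : ∀ n R (f : ℕ → ℕ) → ∑ (upTo n) (λ w → f w * 𝟙 (mem R w)) ≤ ∑ R f
∑-mem≤∑ n R f = begin
  ∑ V (λ w → f w * 𝟙 (mem R w))                    ≤⟨ ∑-mono V (λ w → *-monoʳ-≤ (f w) (𝟙-any≤∑ (w ≡ᵇ_) R)) ⟩
  ∑ V (λ w → f w * ∑ R (λ r → 𝟙 (w ≡ᵇ r)))         ≡⟨ ∑-cong V (λ w → sym (∑-*ˡ R (f w) _)) ⟩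
  ∑ V (λ w → ∑ R (λ r → f w * 𝟙 (w ≡ᵇ r)))         ≡⟨ ∑-swap V R _ ⟩
  ∑ R (λ r → ∑ V (λ w → f w * 𝟙 (w ≡ᵇ r)))         ≤⟨ ∑-mono R (λ r → ∑-mono V (λ w → only-r w r)) ⟩
  ∑ R (λ r → ∑ V (λ w → f r * 𝟙 (r ≡ᵇ w)))         ≡⟨ ∑-cong R (λ r → ∑-*ˡ V (f r) _) ⟩
  ∑ R (λ r → f r * mult r V)                       ≤⟨ ∑-mono R (λ r → *-monoʳ-≤ (f r) (mult-upTo≤1 n r)) ⟩
  ∑ R (λ r → f r * 1)                              ≡⟨ ∑-cong R (λ r → *-identityʳ (f r)) ⟩
  ∑ R f                                            ∎
  where
  open ≤-Reasoning
  V = upTo n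
  only-r : ∀ w r → f w * 𝟙 (w ≡ᵇ r) ≤ f r * 𝟙 (r ≡ᵇ w)
  only-r w r rewrite ≡ᵇ-comm r w with w ≡ᵇ r in e
  ... | true  rewrite ≡ᵇ-true⇒≡ w r e = ≤-refl
  ... | false rewrite *-zeroʳ (f w) = z≤n

⊆⇒∈-sublists : ∀ {A : Set} {xs ys : List A} → xs ⊆ ys → xs ∈ sublists ys
⊆⇒∈-sublists []                 = here refl
⊆⇒∈-sublists (y ∷ʳ p)           = ∈-++⁺ˡ (⊆⇒∈-sublists p)
⊆⇒∈-sublists {ys = y ∷ ys} (refl ∷ p) = ∈-++⁺ʳ (sublists ys) (∈-map⁺ (y ∷_) (⊆⇒∈-sublists p))

∈-insertions : ∀ {A : Set} (x : A) us vs → us ++ x ∷ vs ∈ insertions x (us ++ vs)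
∈-insertions x []       []       = here refl
∈-insertions x []       (v ∷ vs) = here refl
∈-insertions x (u ∷ us) vs       = there (∈-map⁺ (u ∷_) (∈-insertions x us vs))

↭⇒∈-permutations : ∀ {A : Set} (xs : List A) {ys} → ys ↭ xs → ys ∈ permutations xs
↭⇒∈-permutations []       p rewrite ↭-empty-inv p = here refl
↭⇒∈-permutations (x ∷ xs) p with ∈-∃++ (∈-resp-↭ (↭-sym p) (here refl))
... | us , vs , refl = ∈-concatMap⁺ (insertions x)
  (lose (↭⇒∈-permutations xs (drop-mid us [] p)) (∈-insertions x us vs))

-- Degree sums and active vertices.

module _ (E : Graph) where

  degree : ℕ → List ℕ → ℕ
  degree v xs = ∑ xs (𝟙 ∘ adj E v)

  adj-sym : ∀ u v → adj E u v ≡ adj E v u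
  adj-sym u v = go E
    where
    go : ∀ F → adj F u v ≡ adj F v u
    go []      = refl
    go (e ∷ F) = cong₂ _∨_ (∨-comm ((proj₁ e ≡ᵇ u) ∧ (proj₂ e ≡ᵇ v)) _) (go F)

  -- Double counting of edges in both orientations. It is an inequality because a pair may occur
  -- several times in the list E, while adjacency counts it once.
  degree-sum-≤ : ∀ R A → ∑ R (λ u → degree u A) ≤
    ∑ E (λ e → mult (proj₁ e) R * mult (proj₂ e) A + mult (proj₂ e) R * mult (proj₁ e) A)
  degree-sum-≤ R A = begin
    ∑ R (λ u → ∑ A (λ v → 𝟙 (adj E u v)))             ≤⟨ ∑-mono R (λ u → ∑-mono A (λ v → adj≤ u v)) ⟩
    ∑ R (λ u → ∑ A (λ v → ∑ E (λ e → g e u v)))       ≡⟨ ∑-cong R (λ u → ∑-swap A E (λ v e → g e u v)) ⟩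
    ∑ R (λ u → ∑ E (λ e → ∑ A (λ v → g e u v)))       ≡⟨ ∑-swap R E (λ u e → ∑ A (g e u)) ⟩
    ∑ E (λ e → ∑ R (λ u → ∑ A (λ v → g e u v)))       ≡⟨ ∑-cong E split ⟩
    ∑ E (λ e → mult (proj₁ e) R * mult (proj₂ e) A + mult (proj₂ e) R * mult (proj₁ e) A) ∎
    where
    open ≤-Reasoning
    g : ℕ × ℕ → ℕ → ℕ → ℕ
    g (i , j) u v = 𝟙 (i ≡ᵇ u) * 𝟙 (j ≡ᵇ v) + 𝟙 (j ≡ᵇ u) * 𝟙 (i ≡ᵇ v)
    adj≤ : ∀ u v → 𝟙 (adj E u v) ≤ ∑ E (λ e → g e u v)
    adj≤ u v = ≤-trans (𝟙-any≤∑ _ E) (∑-mono E (λ (i , j) →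
      ≤-trans (𝟙-∨-≤ ((i ≡ᵇ u) ∧ (j ≡ᵇ v)) _)
        (+-mono-≤ (≤-reflexive (𝟙-∧ (i ≡ᵇ u) _))
          (≤-reflexive (trans (𝟙-∧ (i ≡ᵇ v) _) (*-comm (𝟙 (i ≡ᵇ v)) _))))))
    product : ∀ (f h : ℕ → ℕ) → ∑ R (λ u → ∑ A (λ v → f u * h v)) ≡ ∑ R f * ∑ A h
    product f h = trans (∑-cong R (λ u → ∑-*ˡ A (f u) h)) (∑-*ʳ R (∑ A h) f)
    split : ∀ e → ∑ R (λ u → ∑ A (λ v → g e u v)) ≡
      mult (proj₁ e) R * mult (proj₂ e) A + mult (proj₂ e) R * mult (proj₁ e) A
    split (i , j) = trans (trans (∑-cong R (λ u → ∑-+ A _ _)) (∑-+ R _ _))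
      (cong₂ _+_ (product (λ u → 𝟙 (i ≡ᵇ u)) (λ v → 𝟙 (j ≡ᵇ v))) (product (λ u → 𝟙 (j ≡ᵇ u)) (λ v → 𝟙 (i ≡ᵇ v))))

  degree-sum-both : ∀ A → (∀ v → mult v A ≤ 1) → ∑ A (λ u → degree u A) ≤ 2 * ∑ E (𝟙 ∘ both A)
  degree-sum-both A nodup = ≤-trans (degree-sum-≤ A A)
    (≤-trans (∑-mono E bound) (≤-reflexive (∑-*ˡ E 2 (𝟙 ∘ both A))))
    where
    m≤ : ∀ v → mult v A ≤ 𝟙 (mem A v)
    m≤ v = mult≤𝟙-mem v A (nodup v)
    bound : ∀ e → mult (proj₁ e) A * mult (proj₂ e) A + mult (proj₂ e) A * mult (proj₁ e) A ≤ 2 * 𝟙 (both A e)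
    bound (i , j) rewrite 𝟙-∧ (mem A i) (mem A j) | +-identityʳ (𝟙 (mem A i) * 𝟙 (mem A j)) =
      +-mono-≤ (*-mono-≤ (m≤ i) (m≤ j))
        (≤-trans (≤-reflexive (*-comm (mult j A) _)) (*-mono-≤ (m≤ i) (m≤ j)))

  degree-sum-touch : ∀ R A → (∀ v → mult v R ≤ 1) → (∀ v → mult v A ≤ 1) →
    ∑ R (λ u → degree u A) ≤ 2 * ∑ E (𝟙 ∘ touch R)
  degree-sum-touch R A nodupR nodupA = ≤-trans (degree-sum-≤ R A)
    (≤-trans (∑-mono E bound) (≤-reflexive (∑-*ˡ E 2 (𝟙 ∘ touch R))))
    where
    m≤ : ∀ v u → mult v R * mult u A ≤ 𝟙 (mem R v)
    m≤ v u = ≤-trans (*-mono-≤ (mult≤𝟙-mem v R (nodupR v)) (nodupA u)) (≤-reflexive (*-identityʳ _))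
    or : ∀ b c → 𝟙 b + 𝟙 c ≤ 2 * 𝟙 (b ∨ c)
    or false false = z≤n
    or false true  = s≤s z≤n
    or true  c     = s≤s (𝟙≤1 c)
    bound : ∀ e → mult (proj₁ e) R * mult (proj₂ e) A + mult (proj₂ e) R * mult (proj₁ e) A ≤ 2 * 𝟙 (touch R e)
    bound (i , j) = ≤-trans (+-mono-≤ (m≤ i j) (m≤ j i)) (or (mem R i) (mem R j))

  heavy active : List ℕ → ℕ → Bool
  heavy  R w = 2 ≤ᵇ degree w R
  active R w = mem R w ∨ heavy R w

  module _ (n : ℕ) where

    private
      V : List ℕ
      V = upTo n

    activeDegree : List ℕ → ℕ → ℕ
    activeDegree R v = ∑ V (λ w → 𝟙 (adj E v w ∧ active R w))

    -- The set of unplaced vertices appears as a sublist of `upTo n` when a vertex is chosen, and as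
    -- a prefix of the ordering afterwards.
    activeDegree-↭ : ∀ {R R′} v → R ↭ R′ → activeDegree R v ≡ activeDegree R′ v
    activeDegree-↭ v p = ∑-cong V (λ w →
      cong₂ (λ a b → 𝟙 (adj E v w ∧ (a ∨ (2 ≤ᵇ b)))) (mem-↭ w p) (∑-↭ (𝟙 ∘ adj E w) p))

    ⊆⇒mult≤1 : ∀ {R} → R ⊆ V → ∀ v → mult v R ≤ 1
    ⊆⇒mult≤1 R⊆V v = ≤-trans (∑-⊆ _ R⊆V) (mult-upTo≤1 n v)

    -- Active neighbours are neighbours, so the degrees over R sum to at least 14 D times its size,
    -- and an edge enters this sum at most twice.
    many-active⇒touch : ∀ D R → R ⊆ V → (∀ {v} → v ∈ R → 14 * D ≤ activeDegree R v) →
      7 * D * length R ≤ ∑ E (𝟙 ∘ touch R)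
    many-active⇒touch D R R⊆V h = *-cancelˡ-≤ 2 (begin
      2 * (7 * D * length R)            ≡⟨ lemma D (length R) ⟩
      length R * (14 * D)               ≤⟨ ∑-lower-bound R (14 * D) h ⟩
      ∑ R (activeDegree R)              ≤⟨ ∑-mono R (λ v → ∑-mono V (λ w → ∧≤ (adj E v w) _)) ⟩
      ∑ R (λ v → degree v V)            ≤⟨ degree-sum-touch R V (⊆⇒mult≤1 R⊆V) (mult-upTo≤1 n) ⟩
      2 * ∑ E (𝟙 ∘ touch R)             ∎)
      where
      open ≤-Reasoning
      lemma : ∀ D s → 2 * (7 * D * s) ≡ s * (14 * D)
      lemma = solve-∀
      ∧≤ : ∀ b c → 𝟙 (b ∧ c) ≤ 𝟙 b
      ∧≤ false c = z≤n
      ∧≤ true  c = 𝟙≤1 c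

    module _ (R : List ℕ) (R⊆V : R ⊆ V) where

      -- The active vertices outside R. Splitting them off keeps `R ++ S` free of repetitions while
      -- it still contains every active vertex.
      outside : ℕ → Bool
      outside w = not (mem R w) ∧ heavy R w

      private
        S : List ℕ
        S = filter (λ w → outside w ≟ true) V

        S⊆V : S ⊆ V
        S⊆V = filter-⊆ (λ w → outside w ≟ true) V

      outside-nodup : ∀ {W} → W ⊆ S → ∀ v → mult v (R ++ W) ≤ 1
      outside-nodup {W} W⊆S v rewrite ∑-++ R W (λ u → 𝟙 (v ≡ᵇ u)) with mem R v in e | mult≤𝟙-mem v R (⊆⇒mult≤1 R⊆V v)
      ... | false | h = +-mono-≤ h (⊆⇒mult≤1 (⊆-trans W⊆S S⊆V) v)
      ... | true  | h = +-mono-≤ h (≤-trans (∑-mono-∈ W absent) (≤-reflexive (∑-zero W)))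
        where
        absent : ∀ {w} → w ∈ W → 𝟙 (v ≡ᵇ w) ≤ 0
        absent {w} w∈W with v ≡ᵇ w in v≡w
        ... | false = z≤n
        ... | true with ∈-filter⁻ (λ w → outside w ≟ true) {xs = V} (lookup W⊆S w∈W)
        ...   | _ , o rewrite sym (≡ᵇ-true⇒≡ v w v≡w) | e with () ← o

      outside-heavy : ∀ {W} → W ⊆ S → ∀ {w} → w ∈ W → 2 ≤ degree w R
      outside-heavy {W} W⊆S {w} w∈W with ∈-filter⁻ (λ w → outside w ≟ true) {xs = V} (lookup W⊆S w∈W)
      ... | _ , o with mem R w | 2 ≤ᵇ degree w R in h
      ...   | false | true = ≤ᵇ⇒≤ 2 _ (subst T (sym h) _)

      activeDegree≤ : ∀ v → activeDegree R v ≤ degree v (R ++ S)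
      activeDegree≤ v = begin
        activeDegree R v
          ≤⟨ ∑-mono V (λ w → cases (adj E v w) (mem R w) (heavy R w)) ⟩
        ∑ V (λ w → 𝟙 (adj E v w) * 𝟙 (mem R w) + 𝟙 (outside w) * 𝟙 (adj E v w))
          ≡⟨ ∑-+ V _ _ ⟩
        ∑ V (λ w → 𝟙 (adj E v w) * 𝟙 (mem R w)) + ∑ V (λ w → 𝟙 (outside w) * 𝟙 (adj E v w))
          ≤⟨ +-mono-≤ (∑-mem≤∑ n R (𝟙 ∘ adj E v)) (≤-reflexive (sym (∑-filter outside V (𝟙 ∘ adj E v)))) ⟩
        degree v R + degree v S
          ≡⟨ ∑-++ R S (𝟙 ∘ adj E v) ⟨
        degree v (R ++ S) ∎
        where
        open ≤-Reasoning
        cases : ∀ a m h → 𝟙 (a ∧ (m ∨ h)) ≤ 𝟙 a * 𝟙 m + 𝟙 (not m ∧ h) * 𝟙 a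
        cases false m     h     = z≤n
        cases true  true  h     = s≤s z≤n
        cases true  false false = z≤n
        cases true  false true  = s≤s z≤n

      dense-from-degrees : ∀ {W} → W ⊆ S → 8 * length R ≤ ∑ (R ++ W) (λ u → degree u (R ++ W)) →
        4 * length R ≤ ∑ E (𝟙 ∘ both (R ++ W))
      dense-from-degrees {W} W⊆S h = *-cancelˡ-≤ 2 (begin
        2 * (4 * length R)                         ≡⟨ *-assoc 2 4 (length R) ⟨
        8 * length R                               ≤⟨ h ⟩
        ∑ (R ++ W) (λ u → degree u (R ++ W))       ≤⟨ degree-sum-both (R ++ W) (outside-nodup W⊆S) ⟩
        2 * ∑ E (𝟙 ∘ both (R ++ W))                ∎)
        where open ≤-Reasoning

      -- If S has at most 2 s members, W = S keeps all active neighbours, so R alone contributes 8 s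
      -- to the degree sum. Otherwise 2 s members of S, each with two neighbours in R, give 4 s
      -- adjacencies, and these are counted from both ends.
      many-active⇒dense : (∀ {v} → v ∈ R → 8 ≤ activeDegree R v) →
        Σ (List ℕ) λ W → W ⊆ V × length W ≤ length R + length R × 4 * length R ≤ ∑ E (𝟙 ∘ both (R ++ W))
      many-active⇒dense h with ≤-total (length R + length R) (length S)
      ... | inj₂ |S|≤2s = S , S⊆V , |S|≤2s , dense-from-degrees ⊆-refl (begin
        8 * length R                                ≡⟨ *-comm 8 (length R) ⟩
        length R * 8                                ≤⟨ ∑-lower-bound R 8 (λ {v} v∈R → ≤-trans (h v∈R) (activeDegree≤ v)) ⟩
        ∑ R (λ u → degree u (R ++ S))               ≤⟨ m≤m+n _ _ ⟩
        ∑ R (λ u → degree u (R ++ S)) + ∑ S (λ u → degree u (R ++ S))  ≡⟨ ∑-++ R S _ ⟨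
        ∑ (R ++ S) (λ u → degree u (R ++ S))        ∎)
        where open ≤-Reasoning
      ... | inj₁ 2s≤|S| = W , ⊆-trans W⊆S S⊆V , ≤-reflexive |W| , dense-from-degrees W⊆S (begin
        8 * length R                                                        ≡⟨ lemma (length R) ⟩
        (length R + length R) * 2 + (length R + length R) * 2               ≡⟨ cong (λ l → l * 2 + l * 2) |W| ⟨
        length W * 2 + length W * 2                                         ≤⟨ +-mono-≤ WR WR ⟩
        ∑ W (λ u → degree u R) + ∑ W (λ u → degree u R)                     ≡⟨ cong (_+ ∑ W (λ u → degree u R)) symmetric ⟩
        ∑ R (λ u → degree u W) + ∑ W (λ u → degree u R)                     ≤⟨ +-mono-≤
          (∑-mono R (λ u → ≤-trans (m≤n+m _ _) (≤-reflexive (sym (∑-++ R W (𝟙 ∘ adj E u))))))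
          (∑-mono W (λ u → ≤-trans (m≤m+n _ _) (≤-reflexive (sym (∑-++ R W (𝟙 ∘ adj E u)))))) ⟩
        ∑ R (λ u → degree u (R ++ W)) + ∑ W (λ u → degree u (R ++ W))       ≡⟨ ∑-++ R W _ ⟨
        ∑ (R ++ W) (λ u → degree u (R ++ W))                                ∎)
        where
        open ≤-Reasoning
        W : List ℕ
        W = take (length R + length R) S
        W⊆S : W ⊆ S
        W⊆S = take-⊆ (length R + length R) S
        |W| : length W ≡ length R + length R
        |W| = trans (length-take (length R + length R) S) (m≤n⇒m⊓n≡m 2s≤|S|)
        WR : length W * 2 ≤ ∑ W (λ u → degree u R)
        WR = ∑-lower-bound W 2 (outside-heavy W⊆S)
        symmetric : ∑ W (λ u → degree u R) ≡ ∑ R (λ u → degree u W)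
        symmetric = trans (∑-swap W R (λ w r → 𝟙 (adj E w r)))
                          (∑-cong R (λ r → ∑-cong W (λ w → cong 𝟙 (adj-sym w r))))
        lemma : ∀ s → 8 * s ≡ (s + s) * 2 + (s + s) * 2
        lemma = solve-∀

-- Construction of the ordering

all-true : ∀ {A : Set} (p : A → Bool) xs → (∀ {x} → x ∈ xs → p x ≡ true) → all p xs ≡ true
all-true p []       h = refl
all-true p (x ∷ xs) h rewrite h (here refl) = all-true p xs (h ∘ there)

listEqᵇ-true⇒≡ : ∀ xs ys → listEqᵇ xs ys ≡ true → xs ≡ ys
listEqᵇ-true⇒≡ []       []       e = refl
listEqᵇ-true⇒≡ (x ∷ xs) (y ∷ ys) e with x ≡ᵇ y in x≡y
... | true = cong₂ _∷_ (≡ᵇ-true⇒≡ x y x≡y) (listEqᵇ-true⇒≡ xs ys e)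

listEqᵇ-refl : ∀ xs → listEqᵇ xs xs ≡ true
listEqᵇ-refl []       = refl
listEqᵇ-refl (x ∷ xs) rewrite ≡ᵇ-refl x = listEqᵇ-refl xs

-- All entries equal to c survive deduplication at most once.
length-deduplicateᵇ : ∀ c xs → length (deduplicateᵇ listEqᵇ xs) ≤ suc (∑ xs (λ x → 𝟙 (not (listEqᵇ c x))))
length-deduplicateᵇ c []       = z≤n
length-deduplicateᵇ c (x ∷ xs) with listEqᵇ c x in eq
... | false = s≤s (≤-trans (length-filter _ (deduplicateᵇ listEqᵇ xs)) (length-deduplicateᵇ c xs))
... | true with refl ← listEqᵇ-true⇒≡ c x eq = s≤s (≤-trans (length-filter-≢ (deduplicateᵇ listEqᵇ xs)) (deduplicate-⊆ xs))
  where
  p : List ℕ → ℕ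
  p y = 𝟙 (not (listEqᵇ c y))
  drop-∑ : ∀ x ys → ∑ (filter (λ y → ¬? (T? (listEqᵇ x y))) ys) p ≤ ∑ ys p
  drop-∑ x ys = ∑-⊆ p (filter-⊆ (λ y → ¬? (T? (listEqᵇ x y))) ys)
  length-filter-≢ : ∀ ys → length (filter (λ y → ¬? (T? (listEqᵇ c y))) ys) ≤ ∑ ys p
  length-filter-≢ []       = z≤n
  length-filter-≢ (y ∷ ys) with listEqᵇ c y
  ... | false = s≤s (length-filter-≢ ys)
  ... | true  = length-filter-≢ ys
  deduplicate-⊆ : ∀ xs → ∑ (deduplicateᵇ listEqᵇ xs) p ≤ ∑ xs p
  deduplicate-⊆ []       = z≤n
  deduplicate-⊆ (x ∷ xs) = +-monoʳ-≤ (p x) (≤-trans (drop-∑ x (deduplicateᵇ listEqᵇ xs)) (deduplicate-⊆ xs))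

take-length-++ : ∀ {A : Set} (xs ys : List A) → take (length xs) (xs ++ ys) ≡ xs
take-length-++ []       ys = refl
take-length-++ (x ∷ xs) ys = cong (x ∷_) (take-length-++ xs ys)

drop-length-++ : ∀ {A : Set} (xs ys : List A) → drop (length xs) (xs ++ ys) ≡ ys
drop-length-++ []       ys = refl
drop-length-++ (x ∷ xs) ys = drop-length-++ xs ys

take-suc-length-++ : ∀ {A : Set} (xs : List A) y ys → take (suc (length xs)) (xs ++ y ∷ ys) ≡ xs ++ [ y ]
take-suc-length-++ []       y ys = refl
take-suc-length-++ (x ∷ xs) y ys = cong (x ∷_) (take-suc-length-++ xs y ys)

drop-suc-length-++ : ∀ {A : Set} (xs : List A) y ys → drop (suc (length xs)) (xs ++ y ∷ ys) ≡ ys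
drop-suc-length-++ []       y ys = refl
drop-suc-length-++ (x ∷ xs) y ys = drop-suc-length-++ xs y ys

≤⇒≤ᵇ-true : ∀ {m n} → m ≤ n → (m ≤ᵇ n) ≡ true
≤⇒≤ᵇ-true {m} {n} m≤n with m ≤ᵇ n | ≤⇒≤ᵇ m≤n
... | true | _ = refl

filter-none : ∀ {A : Set} (p : A → Bool) xs → ∑ xs (𝟙 ∘ p) ≤ 0 → filter (λ x → p x ≟ true) xs ≡ []
filter-none p []       h = refl
filter-none p (x ∷ xs) h with p x
... | false = filter-none p xs h

module _ (E : Graph) (n κ : ℕ) where

  private
    V : List ℕ
    V = upTo n

  -- The second index is the part of the ordering that follows the prefix; it grows from the front
  -- as vertices are placed from the back.
  data GoodPrefix : List ℕ → List ℕ → Set where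
    []   : ∀ {L} → GoodPrefix [] L
    snoc : ∀ {pre v L} → GoodPrefix pre (v ∷ L) → activeDegree E n (pre ++ [ v ]) v < κ →
           GoodPrefix (pre ++ [ v ]) L

  Removable : List ℕ → Set
  Removable R = Σ ℕ λ v → v ∈ R × activeDegree E n R v < κ

  -- Induction on the size of R: a removable vertex v goes last, and the remaining vertices are
  -- ordered in front of `v ∷ L`.
  ordering-exists : (∀ R → R ⊆ V → 1 ≤ length R → Removable R) →
    ∀ k R L → length R ≡ k → R ⊆ V → Σ (List ℕ) λ ord → ord ↭ R × GoodPrefix ord L
  ordering-exists H zero    []      L _ _ = [] , ↭-refl , []
  ordering-exists H (suc k) R       L |R| R⊆V with H R R⊆V (subst (1 ≤_) (sym |R|) (s≤s z≤n))
  ... | v , v∈R , few with ∈-∃++ v∈R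
  ...   | R₁ , R₂ , refl with ordering-exists H k (R₁ ++ R₂) (v ∷ L) shorter (⊆-trans (++⁺ (⊆-refl {x = R₁}) (v ∷ʳ ⊆-refl)) R⊆V)
    where
    shorter : length (R₁ ++ R₂) ≡ k
    shorter = suc-injective (trans (sym (↭-length (shift v R₁ R₂))) |R|)
  ...     | pre , pre↭ , good = pre ++ [ v ] , perm ,
            snoc good (subst (_< κ) (activeDegree-↭ E n v (↭-sym perm)) few)
    where
    perm : pre ++ [ v ] ↭ R₁ ++ [ v ] ++ R₂
    perm = ↭-trans (↭-sym (∷↭∷ʳ v pre)) (↭-trans (Perm.prep v pre↭) (↭-sym (shift v R₁ R₂)))

  -- The rational bound enters the combinatorial argument only through this comparison with κ.
  module _ (d′ : ℚ) (κ≤d′ : ∀ m → m ≤ κ → (ℕtoℚ m ℚ.≤ᵇ d′) ≡ true) where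

    module _ (pre : List ℕ) (v : ℕ) (L : List ℕ) (perm : (pre ++ [ v ]) ++ L ↭ V)
             (few : activeDegree E n (pre ++ [ v ]) v < κ) where

      private
        P : List ℕ
        P = pre ++ [ v ]

        laterNbrs : List ℕ
        laterNbrs = filter (λ w → adj E v w ≟ true) L

        trace : ℕ → List ℕ
        trace w = filter (λ u → adj E w u ≟ true) P

        splitV : activeDegree E n P v ≡ ∑ P (λ w → 𝟙 (adj E v w ∧ active E P w)) + ∑ L (λ w → 𝟙 (adj E v w ∧ active E P w))
        splitV = trans (sym (∑-↭ _ perm)) (∑-++ P L _)

      -- Members of the prefix are active by definition, so every earlier neighbour is counted by
      -- `activeDegree`.
      back-degree≤ : count (adj E v) pre ≤ κ
      back-degree≤ = begin
        count (adj E v) pre                               ≡⟨ length-filter≡∑ (adj E v) pre ⟩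
        ∑ pre (λ w → 𝟙 (adj E v w))                       ≤⟨ m≤m+n _ _ ⟩
        ∑ pre (λ w → 𝟙 (adj E v w)) + ∑ [ v ] (λ w → 𝟙 (adj E v w))  ≡⟨ ∑-++ pre [ v ] _ ⟨
        ∑ P (λ w → 𝟙 (adj E v w))                         ≤⟨ ∑-mono-∈ P (λ {w} w∈P → ≤-reflexive (cong 𝟙 (inside w∈P))) ⟩
        ∑ P (λ w → 𝟙 (adj E v w ∧ active E P w))          ≤⟨ m≤m+n _ _ ⟩
        _                                                 ≡⟨ splitV ⟨
        activeDegree E n P v                              ≤⟨ <⇒≤ few ⟩
        κ                                                 ∎
        where
        open ≤-Reasoning
        inside : ∀ {w} → w ∈ P → adj E v w ≡ adj E v w ∧ active E P w
        inside {w} w∈P rewrite ∈⇒mem w∈P with adj E v w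
        ... | false = refl
        ... | true  = refl

      -- A vertex w with fewer than two neighbours in the prefix already has v as one of them, so it
      -- has none in `pre`.
      light-trace : ∀ w → adj E v w ≡ true → heavy E P w ≡ false → trace w ≡ [ v ]
      light-trace w vw light = begin
        trace w
          ≡⟨ filter-++ (λ u → adj E w u ≟ true) pre [ v ] ⟩
        filter (λ u → adj E w u ≟ true) pre ++ filter (λ u → adj E w u ≟ true) [ v ]
          ≡⟨ cong₂ _++_ (filter-none (adj E w) pre pre-empty) last-kept ⟩
        [ v ] ∎
        where
        open ≡-Reasoning
        wv : adj E w v ≡ true
        wv = trans (adj-sym E w v) vw
        last-kept : filter (λ u → adj E w u ≟ true) [ v ] ≡ [ v ]
        last-kept rewrite wv = refl
        degree<2 : degree E w P < 2
        degree<2 = ≰⇒> (λ 2≤ → subst T light (≤⇒≤ᵇ 2≤))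
        pre-empty : ∑ pre (𝟙 ∘ adj E w) ≤ 0
        pre-empty = s≤s⁻¹ (s≤s⁻¹ (subst (_< 2) (trans (∑-++ pre [ v ] (𝟙 ∘ adj E w))
          (trans (cong (λ b → ∑ pre (𝟙 ∘ adj E w) + (𝟙 b + 0)) wv) (+-comm _ 1))) degree<2))

      -- The inactive later neighbours share the trace {v}, and every other trace is charged to an
      -- active later neighbour. The strict inequality in `few` pays for the one shared trace.
      traces≤ : length (deduplicateᵇ listEqᵇ (map trace laterNbrs)) ≤ κ
      traces≤ = begin
        length (deduplicateᵇ listEqᵇ (map trace laterNbrs))
          ≤⟨ length-deduplicateᵇ [ v ] (map trace laterNbrs) ⟩
        suc (∑ (map trace laterNbrs) (λ t → 𝟙 (not (listEqᵇ [ v ] t))))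
          ≡⟨ cong suc (∑-map trace laterNbrs _) ⟩
        suc (∑ laterNbrs (λ w → 𝟙 (not (listEqᵇ [ v ] (trace w)))))
          ≡⟨ cong suc (∑-filter (adj E v) L _) ⟩
        suc (∑ L (λ w → 𝟙 (adj E v w) * 𝟙 (not (listEqᵇ [ v ] (trace w)))))
          ≤⟨ s≤s (∑-mono L distinct) ⟩
        suc (∑ L (λ w → 𝟙 (adj E v w ∧ active E P w)))
          ≤⟨ s≤s (m≤n+m _ _) ⟩
        suc _
          ≡⟨ cong suc splitV ⟨
        suc (activeDegree E n P v)
          ≤⟨ few ⟩
        κ ∎
        where
        open ≤-Reasoning
        distinct : ∀ w → 𝟙 (adj E v w) * 𝟙 (not (listEqᵇ [ v ] (trace w))) ≤ 𝟙 (adj E v w ∧ active E P w)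
        distinct w with adj E v w in vw
        ... | false = z≤n
        ... | true with mem P w | heavy E P w in h
        ...   | true  | _     = ≤-trans (≤-reflexive (+-identityʳ _)) (𝟙≤1 _)
        ...   | false | true  = ≤-trans (≤-reflexive (+-identityʳ _)) (𝟙≤1 _)
        ...   | false | false rewrite light-trace w vw h | listEqᵇ-refl [ v ] = z≤n

      goodAt-split : goodAt E d′ d′ (pre ++ v ∷ L) (length pre) ≡ true
      goodAt-split = trans
        (cong₂ (λ f l → f l) (cong₂ test (take-suc-length-++ pre v L) (take-length-++ pre (v ∷ L)))
          (cong₂ _,_ (drop-suc-length-++ pre v L) (cong (foldr (λ x _ → x) 0) (drop-length-++ pre (v ∷ L)))))
        (cong₂ _∧_ (κ≤d′ (count (adj E v) pre) back-degree≤)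
          (κ≤d′ (length (deduplicateᵇ listEqᵇ (map trace laterNbrs))) traces≤))
        where
        -- The two conditions of `goodAt` with prefix, earlier part, later part and vertex
        -- abstracted, so that the equations for `take` and `drop` can be substituted.
        test : List ℕ → List ℕ → List ℕ × ℕ → Bool
        test prefix earlier (later , v) =
          (ℕtoℚ (count (adj E v) earlier) ℚ.≤ᵇ d′) ∧
          (ℕtoℚ (length (deduplicateᵇ listEqᵇ
            (map (λ w → filter (λ u → adj E w u ≟ true) prefix) (filter (λ w → adj E v w ≟ true) later)))) ℚ.≤ᵇ d′)

    -- The whole list stays the same when the last vertex v of the prefix moves to the front of L.
    -- Position `length pre` is settled by the removability of v, earlier positions by the shorter
    -- prefix.
    goodAt-prefix : ∀ {pre L} → GoodPrefix pre L → pre ++ L ↭ V → ∀ i → i < length pre →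
      goodAt E d′ d′ (pre ++ L) i ≡ true
    goodAt-prefix (snoc {pre} {v} {L} good few) perm i i<len =
      subst (λ o → goodAt E d′ d′ o i ≡ true) (sym (++-assoc pre [ v ] L)) (earlier-or-last (m≤n⇒m<n∨m≡n i≤pre))
      where
      i≤pre : i ≤ length pre
      i≤pre = ≤-pred (subst (i <_) (trans (length-++ pre) (+-comm _ 1)) i<len)
      earlier-or-last : i < length pre ⊎ i ≡ length pre → goodAt E d′ d′ (pre ++ v ∷ L) i ≡ true
      earlier-or-last (inj₁ i<pre) = goodAt-prefix good (subst (_↭ V) (++-assoc pre [ v ] L) perm) i i<pre
      earlier-or-last (inj₂ i≡pre) = subst (λ i → goodAt E d′ d′ (pre ++ v ∷ L) i ≡ true) (sym i≡pre)
                                       (goodAt-split pre v L perm few)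

    degenerate : (∀ R → R ⊆ V → 1 ≤ length R → Removable R) → degenerateᵇ n d′ d′ E ≡ true
    degenerate H = go (ordering-exists H (length V) V [] refl ⊆-refl)
      where
      go : Σ (List ℕ) (λ ord → ord ↭ V × GoodPrefix ord []) → degenerateᵇ n d′ d′ E ≡ true
      go (ord , ord↭V , good) =
        any-∈ (goodOrdering E d′ d′) (↭⇒∈-permutations V ord↭V)
          (all-true (goodAt E d′ d′ ord) (upTo (length ord)) (λ {i} i∈ →
            subst (λ o → goodAt E d′ d′ o i ≡ true) (++-identityʳ ord)
              (goodAt-prefix good (subst (_↭ V) (sym (++-identityʳ ord)) ord↭V) i (∈-upTo⁻ i∈))))

badEvent : ℕ → ℕ → ℕ → Graph → ℕ
badEvent n D s E = if scale D * s ≤ᵇ n then denseEvent n s E else touchEvent n D s E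

module _ (E : Graph) (n D : ℕ) (1≤D : 1 ≤ D) where

  private
    V : List ℕ
    V = upTo n

  stuck⇒dense : ∀ R → R ⊆ V → (∀ {v} → v ∈ R → 14 * D ≤ activeDegree E n R v) → 1 ≤ denseEvent n (length R) E
  stuck⇒dense R R⊆V h = go (many-active⇒dense E n R R⊆V (λ v∈R → ≤-trans 8≤14D (h v∈R)))
    where
    s = length R
    8≤14D : 8 ≤ 14 * D
    8≤14D = ≤-trans (m≤m+n 8 6) (*-monoʳ-≤ 14 1≤D)
    term : List ℕ → List ℕ → ℕ
    term R W = 𝟙 (length R ≤ᵇ s) * (𝟙 (length W ≤ᵇ s + s) * 𝟙 (4 * s ≤ᵇ ∑ E (𝟙 ∘ both (R ++ W))))
    term≡1 : ∀ {W} → length W ≤ s + s → 4 * s ≤ ∑ E (𝟙 ∘ both (R ++ W)) → 1 ≡ term R W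
    term≡1 |W| dense rewrite ≤⇒≤ᵇ-true (≤-refl {s}) | ≤⇒≤ᵇ-true |W| | ≤⇒≤ᵇ-true dense = refl
    go : Σ (List ℕ) (λ W → W ⊆ V × length W ≤ s + s × 4 * s ≤ ∑ E (𝟙 ∘ both (R ++ W))) → 1 ≤ denseEvent n s E
    go (W , W⊆V , |W| , dense) = ≤-trans (≤-reflexive (term≡1 |W| dense))
      (≤-trans (f≤∑ (term R) (⊆⇒∈-sublists W⊆V)) (f≤∑ (λ R → ∑ (sublists V) (term R)) (⊆⇒∈-sublists R⊆V)))

  stuck⇒touch : ∀ R → R ⊆ V → (∀ {v} → v ∈ R → 14 * D ≤ activeDegree E n R v) → 1 ≤ touchEvent n D (length R) E
  stuck⇒touch R R⊆V h = ≤-trans (≤-reflexive term≡1) (f≤∑ term (⊆⇒∈-sublists R⊆V))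
    where
    s = length R
    term : List ℕ → ℕ
    term R = 𝟙 (length R ≤ᵇ s) * 𝟙 (7 * D * s ≤ᵇ ∑ E (𝟙 ∘ touch R))
    term≡1 : 1 ≡ term R
    term≡1 = sym (cong₂ (λ a b → 𝟙 a * 𝟙 b) (≤⇒≤ᵇ-true (≤-refl {s})) (≤⇒≤ᵇ-true (many-active⇒touch E n D R R⊆V h)))

  1≤if : ∀ b {x y : ℕ} → 1 ≤ x → 1 ≤ y → 1 ≤ (if b then x else y)
  1≤if true  p q = p
  1≤if false p q = q

  -- A stuck set witnesses both kinds of event, so either branch of `badEvent` is positive; the
  -- choice of branch matters for its probability.
  removable-or-bad : ∀ R → R ⊆ V → Removable E n (14 * D) R ⊎ 1 ≤ badEvent n D (length R) E
  removable-or-bad R R⊆V with any? (λ v → activeDegree E n R v <? 14 * D) R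
  ... | yes p = inj₁ (find p)
  ... | no ¬p = inj₂ (1≤if (scale D * length R ≤ᵇ n) (stuck⇒dense R R⊆V stuck) (stuck⇒touch R R⊆V stuck))
    where
    stuck : ∀ {v} → v ∈ R → 14 * D ≤ activeDegree E n R v
    stuck v∈R = ≮⇒≥ (λ few → ¬p (lose v∈R few))

  -- Stated as an inequality of counts so that expectations can be taken at once. Index i stands for
  -- sets of size i + 1, since only nonempty sets need a removable vertex.
  degenerate-or-bad : ∀ d′ → (∀ m → m ≤ 14 * D → (ℕtoℚ m ℚ.≤ᵇ d′) ≡ true) →
    1 ≤ 𝟙 (degenerateᵇ n d′ d′ E) + ∑ (upTo n) (λ i → badEvent n D (suc i) E)
  degenerate-or-bad d′ κ≤d′ =
    1≤a+b (𝟙 (degenerateᵇ n d′ d′ E)) (∑ (upTo n) bad)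
      (λ no-bad → cong 𝟙 (degenerate E n (14 * D) d′ κ≤d′ (removable no-bad)))
    where
    bad : ℕ → ℕ
    bad i = badEvent n D (suc i) E
    1≤a+b : ∀ a b → (b ≡ 0 → a ≡ 1) → 1 ≤ a + b
    1≤a+b a zero    h = ≤-trans (≤-reflexive (sym (h refl))) (m≤m+n a 0)
    1≤a+b a (suc b) h = ≤-trans (s≤s z≤n) (m≤n+m (suc b) a)
    removable : ∑ (upTo n) bad ≡ 0 → ∀ R → R ⊆ V → 1 ≤ length R → Removable E n (14 * D) R
    removable no-bad R R⊆V 1≤|R| = choose (length R) 1≤|R| (subst (length R ≤_) (length-upTo n) (length-mono-≤ R⊆V))
      (removable-or-bad R R⊆V)
      where
      choose : ∀ s → 1 ≤ s → s ≤ n → Removable E n (14 * D) R ⊎ 1 ≤ badEvent n D s E → Removable E n (14 * D) R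
      choose s       _ _   (inj₁ r) = r
      choose (suc i) _ i<n (inj₂ b) = ⊥-elim (<⇒≱ b (subst (bad i ≤_) no-bad (f≤∑ bad (∈-upTo⁺ i<n))))

-- The union bound

geometric-sum : ∀ n (g : ℕ → ℕ) C → (∀ i → i < n → 2 ^ suc i * g i ≤ C) → ∑ (upTo n) g ≤ C
geometric-sum n g C h = cancelˡ (m^n≥1 {2} n (s≤s z≤n)) (≤-trans (m≤m+n _ C) (go n h))
  where
  open ≤-Reasoning
  lemma₁ : ∀ t S x C → 2 * t * (S + x) + C ≡ 2 * (t * S) + 2 * t * x + C
  lemma₁ = solve-∀
  lemma₂ : ∀ a C → 2 * a + C + C ≡ 2 * (a + C)
  lemma₂ = solve-∀
  -- The induction carries the sharper bound (1 - 2^(-n)) C on the sum.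
  go : ∀ n → (∀ i → i < n → 2 ^ suc i * g i ≤ C) → 2 ^ n * ∑ (upTo n) g + C ≤ 2 ^ n * C
  go zero    h = ≤-reflexive (sym (+-identityʳ C))
  go (suc n) h rewrite ∑-upTo n g = begin
    2 ^ suc n * (∑ (upTo n) g + g n) + C                ≡⟨ lemma₁ (2 ^ n) (∑ (upTo n) g) (g n) C ⟩
    2 * (2 ^ n * ∑ (upTo n) g) + 2 ^ suc n * g n + C    ≤⟨ +-monoˡ-≤ C (+-monoʳ-≤ (2 * (2 ^ n * ∑ (upTo n) g)) (h n ≤-refl)) ⟩
    2 * (2 ^ n * ∑ (upTo n) g) + C + C                  ≡⟨ lemma₂ (2 ^ n * ∑ (upTo n) g) C ⟩
    2 * (2 ^ n * ∑ (upTo n) g + C)                      ≤⟨ *-monoʳ-≤ 2 (go n (λ i i<n → h i (m<n⇒m<1+n i<n))) ⟩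
    2 * (2 ^ n * C)                                     ≡⟨ *-assoc 2 (2 ^ n) C ⟨
    2 ^ suc n * C                                       ∎

-- From K to K + 1 the left side grows by a factor of at most 2^4 · 4 = 64, as K + 1 ≤ 2 K, while
-- the right side grows by 2^7 = 128.
fourth-power-growth : ∀ c → c * (10 ^ 4 * 4 ^ 10) ≤ 2 ^ (7 * 10) → ∀ k →
  c * ((k + 10) ^ 4 * 4 ^ (k + 10)) ≤ 2 ^ (7 * (k + 10))
fourth-power-growth c h zero    = h
fourth-power-growth c h (suc k) = step (k + 10) (≤-trans (s≤s z≤n) (m≤n+m 10 k)) (fourth-power-growth c h k)
  where
  open ≤-Reasoning
  pull : ∀ u f x → f * (u * x) ≡ u * (f * x)
  pull = solve-∀
  fourth : ∀ a f q → (a + a) * ((a + a) * ((a + a) * ((a + a) * 1))) * (f * q) ≡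
    2 * (2 * (2 * (2 * f))) * (a * (a * (a * (a * 1))) * q)
  fourth = solve-∀
  step : ∀ K → 1 ≤ K → c * (K ^ 4 * 4 ^ K) ≤ 2 ^ (7 * K) → c * (suc K ^ 4 * 4 ^ suc K) ≤ 2 ^ (7 * suc K)
  step K 1≤K ih = begin
    c * (suc K ^ 4 * 4 ^ suc K)          ≤⟨ *-monoʳ-≤ c (*-monoˡ-≤ (4 ^ suc K) (^-mono 4 (+-monoˡ-≤ K 1≤K))) ⟩
    c * ((K + K) ^ 4 * 4 ^ suc K)        ≡⟨ cong (c *_) (fourth K 4 (4 ^ K)) ⟩
    c * (64 * (K ^ 4 * 4 ^ K))           ≡⟨ pull 64 c (K ^ 4 * 4 ^ K) ⟩
    64 * (c * (K ^ 4 * 4 ^ K))           ≤⟨ *-mono-≤ (m≤m+n 64 64) ih ⟩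
    2 ^ 7 * 2 ^ (7 * K)                  ≡⟨ ^-distribˡ-+-* 2 7 (7 * K) ⟨
    2 ^ (7 + 7 * K)                      ≡⟨ cong (2 ^_) (*-suc 7 K) ⟨
    2 ^ (7 * suc K)                      ∎

scale-threshold : ∀ D → 10 ≤ D → 4 * scale D * 4 * 4 ^ D ≤ 2 ^ (7 * D)
scale-threshold D 10≤D = ≤-trans (≤-reflexive (collect 4 16 (D ^ 4) (4 ^ 9) (4 ^ D)))
  (subst (λ D → 4 * 4 * 16 * 4 * 4 * 4 * 4 ^ 9 * (D ^ 4 * 4 ^ D) ≤ 2 ^ (7 * D)) (m∸n+n≡m 10≤D)
    -- The base case at 10 reads 2^52 · 10^4 ≤ 2^70 and is checked by evaluation.
    (fourth-power-growth (4 * 4 * 16 * 4 * 4 * 4 * 4 ^ 9) (≤ᵇ⇒≤ _ _ _) (D ∸ 10)))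
  where
  collect : ∀ p r a b q → p * (p * (r * a * p * p * b)) * p * q ≡ p * p * r * p * p * p * b * (a * q)
  collect = solve-∀

if-elim : ∀ {X : Set} (P : (X → ℕ) → Set) b {f g : X → ℕ} → (T b → P f) → (¬ T b → P g) →
          P (λ x → if b then f x else g x)
if-elim P true  h k = h _
if-elim P false h k = k id

module _ (n D A B : ℕ) (1≤n : 1 ≤ n) (10≤D : 10 ≤ D) (An≤DQ : A * n ≤ D * (A + B)) where

  open Expectation A B

  private
    1≤D : 1 ≤ D
    1≤D = ≤-trans (s≤s z≤n) 10≤D

    tot : ℕ
    tot = (A + B) ^ length (pairs n)

  open Bounds n D A B 1≤n 1≤D An≤DQ

  badEvent-unlikely : ∀ s → 1 ≤ s → s ≤ n → 2 ^ s * (n * 𝔼 (pairs n) (badEvent n D s)) ≤ scale D * tot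
  badEvent-unlikely s 1≤s s≤n =
    if-elim (λ f → 2 ^ s * (n * 𝔼 (pairs n) f) ≤ scale D * tot) (scale D * s ≤ᵇ n)
      (λ Ms≤n → denseEvent-unlikely s 1≤s (≤ᵇ⇒≤ (scale D * s) n Ms≤n))
      (λ Ms≰n → touchEvent-unlikely s 1≤s s≤n (<⇒≤ (≰⇒> (λ Ms≤n → Ms≰n (≤⇒≤ᵇ Ms≤n)))) (scale-threshold D 10≤D))

  -- Expectation of `degenerate-or-bad`: the events for size s cost at most 2^(-s) M / n with M =
  -- `scale D`, so the failure probability is at most M / n.
  degenerate-likely : ∀ d′ → (∀ m → m ≤ 14 * D → (ℕtoℚ m ℚ.≤ᵇ d′) ≡ true) →
    n * tot ≤ n * 𝔼 (pairs n) (λ E → 𝟙 (degenerateᵇ n d′ d′ E)) + scale D * tot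
  degenerate-likely d′ κ≤d′ = begin
    n * tot                       ≡⟨ cong (n *_) (trans (sym (*-identityʳ tot)) (sym (𝔼-const (pairs n) 1))) ⟩
    n * 𝔼 (pairs n) (λ _ → 1)     ≤⟨ *-monoʳ-≤ n (𝔼-mono (pairs n) (λ E → degenerate-or-bad E n D 1≤D d′ κ≤d′)) ⟩
    n * 𝔼 (pairs n) (λ E → good E + ∑ (upTo n) (λ i → bad i E))
      ≡⟨ cong (n *_) (trans (𝔼-+ (pairs n) good _) (cong (λ t → 𝔼 (pairs n) good + t) (𝔼-∑ (pairs n) (upTo n) bad))) ⟩
    n * (𝔼 (pairs n) good + ∑ (upTo n) (λ i → 𝔼 (pairs n) (bad i)))
      ≡⟨ *-distribˡ-+ n (𝔼 (pairs n) good) _ ⟩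
    n * 𝔼 (pairs n) good + n * ∑ (upTo n) (λ i → 𝔼 (pairs n) (bad i))
      ≡⟨ cong (λ t → n * 𝔼 (pairs n) good + t) (sym (∑-*ˡ (upTo n) n _)) ⟩
    n * 𝔼 (pairs n) good + ∑ (upTo n) (λ i → n * 𝔼 (pairs n) (bad i))
      ≤⟨ +-monoʳ-≤ (n * 𝔼 (pairs n) good) (geometric-sum n _ (scale D * tot) (λ i i<n → badEvent-unlikely (suc i) (s≤s z≤n) i<n)) ⟩
    n * 𝔼 (pairs n) good + scale D * tot ∎
    where
    open ≤-Reasoning
    good : Graph → ℕ
    good E = 𝟙 (degenerateᵇ n d′ d′ E)
    bad : ℕ → Graph → ℕ
    bad i = badEvent n D (suc i)

-- Rational probabilities

toℚᵘ-ℕtoℚ : ∀ k → ℚ.toℚᵘ (ℕtoℚ k) ≃ mkℚᵘ (+ k) 0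
toℚᵘ-ℕtoℚ k = ℚ.toℚᵘ-fromℚᵘ (mkℚᵘ (+ k) 0)

ℕtoℚ-+ : ∀ a b → ℕtoℚ (a + b) ≡ ℕtoℚ a ℚ.+ ℕtoℚ b
ℕtoℚ-+ a b = ℚ.toℚᵘ-injective (ℚᵘ.≃-trans (toℚᵘ-ℕtoℚ (a + b)) (ℚᵘ.≃-sym
  (ℚᵘ.≃-trans (ℚ.toℚᵘ-homo-+ (ℕtoℚ a) (ℕtoℚ b))
    (ℚᵘ.≃-trans (ℚᵘ.+-cong (toℚᵘ-ℕtoℚ a) (toℚᵘ-ℕtoℚ b)) (*≡* equation)))))
  where
  equation : (+ a ℤ.* + 1 ℤ.+ + b ℤ.* + 1) ℤ.* + 1 ≡ + (a + b) ℤ.* + 1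
  equation = cong (ℤ._* + 1) (cong₂ ℤ._+_ (ℤ.*-identityʳ (+ a)) (ℤ.*-identityʳ (+ b)))

ℕtoℚ-* : ∀ a b → ℕtoℚ (a * b) ≡ ℕtoℚ a ℚ.* ℕtoℚ b
ℕtoℚ-* a b = ℚ.toℚᵘ-injective (ℚᵘ.≃-trans (toℚᵘ-ℕtoℚ (a * b)) (ℚᵘ.≃-sym
  (ℚᵘ.≃-trans (ℚ.toℚᵘ-homo-* (ℕtoℚ a) (ℕtoℚ b))
    (ℚᵘ.≃-trans (ℚᵘ.*-cong (toℚᵘ-ℕtoℚ a) (toℚᵘ-ℕtoℚ b)) (*≡* equation)))))
  where
  equation : + a ℤ.* + b ℤ.* + 1 ≡ + (a * b) ℤ.* + 1
  equation = cong (ℤ._* + 1) (sym (ℤ.pos-* a b))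

ℕtoℚ-mono : ∀ {a b} → a ≤ b → ℕtoℚ a ℚ.≤ ℕtoℚ b
ℕtoℚ-mono {a} {b} a≤b = ℚ.toℚᵘ-cancel-≤ (ℚᵘ.≤-respˡ-≃ (ℚᵘ.≃-sym (toℚᵘ-ℕtoℚ a))
  (ℚᵘ.≤-respʳ-≃ (ℚᵘ.≃-sym (toℚᵘ-ℕtoℚ b))
    (ℚᵘ.*≤* (ℤ.*-monoʳ-≤-nonNeg (+ 1) (ℤ.+≤+ a≤b)))))

ℕtoℚ-pos : ∀ {a} → 1 ≤ a → ℚ.Positive (ℕtoℚ a)
ℕtoℚ-pos {suc a} _ = ℚ.normalize-pos (suc a) 1

denominator-* : ∀ k m .(c : Coprime k (suc m)) → ℕtoℚ (suc m) ℚ.* mkℚ (+ k) m c ≡ ℕtoℚ k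
denominator-* k m c = ℚ.toℚᵘ-injective (ℚᵘ.≃-trans (ℚ.toℚᵘ-homo-* (ℕtoℚ (suc m)) (mkℚ (+ k) m c))
  (ℚᵘ.≃-trans (ℚᵘ.*-congʳ (toℚᵘ-ℕtoℚ (suc m))) (ℚᵘ.≃-trans (*≡* equation) (ℚᵘ.≃-sym (toℚᵘ-ℕtoℚ k)))))
  where
  equation : + suc m ℤ.* + k ℤ.* + 1 ≡ + k ℤ.* + (1 * suc m)
  equation = trans (ℤ.*-identityʳ _) (trans (ℤ.*-comm (+ suc m) (+ k))
    (cong (λ t → + k ℤ.* + t) (sym (*-identityˡ (suc m)))))

suc-*-1/suc : ∀ m → ℕtoℚ (suc m) ℚ.* ((+ 1) ℚ./ suc m) ≡ 1ℚ
suc-*-1/suc m = ℚ.toℚᵘ-injective (ℚᵘ.≃-trans (ℚ.toℚᵘ-homo-* (ℕtoℚ (suc m)) ((+ 1) ℚ./ suc m))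
  (ℚᵘ.≃-trans (ℚᵘ.*-cong (toℚᵘ-ℕtoℚ (suc m)) (ℚ.toℚᵘ-fromℚᵘ (mkℚᵘ (+ 1) m))) (*≡* equation)))
  where
  equation : + suc m ℤ.* + 1 ℤ.* + 1 ≡ + 1 ℤ.* + (1 * suc m)
  equation = trans (ℤ.*-identityʳ _) (trans (ℤ.*-comm (+ suc m) (+ 1))
    (cong (λ t → + 1 ℤ.* + t) (sym (*-identityˡ (suc m)))))

swap-* : ∀ a b c → a ℚ.* (b ℚ.* c) ≡ b ℚ.* (a ℚ.* c)
swap-* a b c = trans (sym (ℚ.*-assoc a b c)) (trans (cong (ℚ._* c) (ℚ.*-comm a b)) (ℚ.*-assoc b a c))

-- Rational graph weights as scaled expectations.

module _ (p q : ℚ) where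

  weight : ℕ → ℕ → ℚ
  weight N k = (p ^ℚ k) ℚ.* (q ^ℚ (N ∸ k))

  -- The sum in `prob`, with the list of graphs and the number N of pairs left free for the
  -- induction over the pairs.
  mass : ℕ → (Graph → Bool) → List Graph → ℚ
  mass N P Es = foldr ℚ._+_ 0ℚ (map (λ E → if P E then weight N (length E) else 0ℚ) Es)

  mass-++ : ∀ N P Es Fs → mass N P (Es ++ Fs) ≡ mass N P Es ℚ.+ mass N P Fs
  mass-++ N P []       Fs = sym (ℚ.+-identityˡ _)
  mass-++ N P (E ∷ Es) Fs = trans (cong (w ℚ.+_) (mass-++ N P Es Fs)) (sym (ℚ.+-assoc w _ _))
    where w = if P E then weight N (length E) else 0ℚ

  if-* : ∀ b {x y} z → x ≡ z ℚ.* y → (if b then x else 0ℚ) ≡ z ℚ.* (if b then y else 0ℚ)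
  if-* true  z e = e
  if-* false z e = sym (ℚ.*-zeroʳ z)

  weight-suc : ∀ N k → k ≤ N → weight (suc N) k ≡ q ℚ.* weight N k
  weight-suc N k k≤N = trans (cong (λ m → (p ^ℚ k) ℚ.* (q ^ℚ m)) (+-∸-assoc 1 k≤N)) (swap-* (p ^ℚ k) q (q ^ℚ (N ∸ k)))

  -- Omitting the first pair costs one factor q. The length bound ensures that the truncated
  -- difference really grows by one with N.
  mass-absent : ∀ N P Es → (∀ {E} → E ∈ Es → length E ≤ N) → mass (suc N) P Es ≡ q ℚ.* mass N P Es
  mass-absent N P []       h = sym (ℚ.*-zeroʳ q)
  mass-absent N P (E ∷ Es) h = trans
    (cong₂ ℚ._+_ (if-* (P E) q (weight-suc N (length E) (h (here refl)))) (mass-absent N P Es (h ∘ there)))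
    (sym (ℚ.*-distribˡ-+ q (if P E then weight N (length E) else 0ℚ) (mass N P Es)))

  mass-present : ∀ N P e Es → mass (suc N) P (map (e ∷_) Es) ≡ p ℚ.* mass N (P ∘ (e ∷_)) Es
  mass-present N P e []       = sym (ℚ.*-zeroʳ p)
  mass-present N P e (E ∷ Es) = trans
    (cong₂ ℚ._+_ (if-* (P (e ∷ E)) p (ℚ.*-assoc p _ _)) (mass-present N P e Es))
    (sym (ℚ.*-distribˡ-+ p (if P (e ∷ E) then weight N (length E) else 0ℚ) (mass N (P ∘ (e ∷_)) Es)))

  length-sublist : ∀ (es : Graph) {E} → E ∈ sublists es → length E ≤ length es
  length-sublist []       (here refl) = z≤n
  length-sublist (e ∷ es) E∈ with ∈-++⁻ (sublists es) E∈
  ... | inj₁ E∈′ = m≤n⇒m≤1+n (length-sublist es E∈′)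
  ... | inj₂ E∈′ with ∈-map⁻ (e ∷_) E∈′
  ...   | E′ , E′∈ , refl = s≤s (length-sublist es E′∈)

  -- With p = A / (A + B) and q = B / (A + B), both sides obey the same recursion on whether the
  -- first pair is an edge, with one factor A + B per pair.
  mass-𝔼 : ∀ A B → ℕtoℚ (A + B) ℚ.* p ≡ ℕtoℚ A → ℕtoℚ (A + B) ℚ.* q ≡ ℕtoℚ B → ∀ es P →
    ℕtoℚ ((A + B) ^ length es) ℚ.* mass (length es) P (sublists es) ≡ ℕtoℚ (Expectation.𝔼 A B es (𝟙 ∘ P))
  mass-𝔼 A B Qp Qq []       P = base (P [])
    where
    base : ∀ b → ℕtoℚ 1 ℚ.* ((if b then weight 0 0 else 0ℚ) ℚ.+ 0ℚ) ≡ ℕtoℚ (𝟙 b)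
    base true  = refl
    base false = refl
  mass-𝔼 A B Qp Qq (e ∷ es) P = begin
    ℕtoℚ (Q * Q ^ m) ℚ.* mass (suc m) P (sublists es ++ map (e ∷_) (sublists es))
      ≡⟨ cong₂ ℚ._*_ (ℕtoℚ-* Q (Q ^ m)) (trans (mass-++ (suc m) P (sublists es) _)
           (cong₂ ℚ._+_ (mass-absent m P (sublists es) (length-sublist es)) (mass-present m P e (sublists es)))) ⟩
    (ℕtoℚ Q ℚ.* ℕtoℚ (Q ^ m)) ℚ.* (q ℚ.* u ℚ.+ p ℚ.* v)
      ≡⟨ rearrange (ℕtoℚ Q) (ℕtoℚ (Q ^ m)) u v ⟩
    (ℕtoℚ Q ℚ.* q) ℚ.* (ℕtoℚ (Q ^ m) ℚ.* u) ℚ.+ (ℕtoℚ Q ℚ.* p) ℚ.* (ℕtoℚ (Q ^ m) ℚ.* v)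
      ≡⟨ cong₂ ℚ._+_ (cong₂ ℚ._*_ Qq (mass-𝔼 A B Qp Qq es P)) (cong₂ ℚ._*_ Qp (mass-𝔼 A B Qp Qq es (P ∘ (e ∷_)))) ⟩
    ℕtoℚ B ℚ.* ℕtoℚ x ℚ.+ ℕtoℚ A ℚ.* ℕtoℚ y
      ≡⟨ cong₂ ℚ._+_ (ℕtoℚ-* B x) (ℕtoℚ-* A y) ⟨
    ℕtoℚ (B * x) ℚ.+ ℕtoℚ (A * y)
      ≡⟨ ℕtoℚ-+ (B * x) (A * y) ⟨
    ℕtoℚ (B * x + A * y) ∎
    where
    open ≡-Reasoning
    Q = A + B
    m = length es
    u = mass m P (sublists es)
    v = mass m (P ∘ (e ∷_)) (sublists es)
    x = Expectation.𝔼 A B es (𝟙 ∘ P)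
    y = Expectation.𝔼 A B es (𝟙 ∘ P ∘ (e ∷_))
    exchange : ∀ a b c d → (a ℚ.* b) ℚ.* (c ℚ.* d) ≡ (a ℚ.* c) ℚ.* (b ℚ.* d)
    exchange a b c d = trans (ℚ.*-assoc a b (c ℚ.* d)) (trans (cong (a ℚ.*_) (swap-* b c d)) (sym (ℚ.*-assoc a c (b ℚ.* d))))
    rearrange : ∀ a b u v → (a ℚ.* b) ℚ.* (q ℚ.* u ℚ.+ p ℚ.* v) ≡
      (a ℚ.* q) ℚ.* (b ℚ.* u) ℚ.+ (a ℚ.* p) ℚ.* (b ℚ.* v)
    rearrange a b u v = trans (ℚ.*-distribˡ-+ (a ℚ.* b) (q ℚ.* u) (p ℚ.* v)) (cong₂ ℚ._+_ (exchange a b q u) (exchange a b p v))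

x≡x+y-y : ∀ x y → (x ℚ.+ y) ℚ.- y ≡ x
x≡x+y-y x y = trans (ℚ.+-assoc x y (ℚ.- y)) (trans (cong (x ℚ.+_) (ℚ.+-inverseʳ y)) (ℚ.+-identityʳ x))

≤+⇒-≤ : ∀ x y z → x ℚ.≤ y ℚ.+ z → x ℚ.- z ℚ.≤ y
≤+⇒-≤ x y z h = subst (x ℚ.- z ℚ.≤_) (x≡x+y-y y z) (ℚ.+-monoˡ-≤ (ℚ.- z) h)

-- Division of the hypothesis by n t gives 1 ≤ P + M / n ≤ P + ε.
lower-bound-transfer : ∀ n M t g (P ε : ℚ) → 1 ≤ n → 1 ≤ t → n * t ≤ n * g + M * t →
  ℕtoℚ t ℚ.* P ≡ ℕtoℚ g → ℕtoℚ M ℚ.≤ ℕtoℚ n ℚ.* ε → 1ℚ ℚ.- ε ℚ.≤ P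
lower-bound-transfer n M t g P ε 1≤n 1≤t h tP M≤nε =
  ≤+⇒-≤ 1ℚ P ε (ℚ.*-cancelˡ-≤-pos (ℕtoℚ n) {{ℕtoℚ-pos 1≤n}} (begin
    ℕtoℚ n ℚ.* 1ℚ                    ≡⟨ ℚ.*-identityʳ (ℕtoℚ n) ⟩
    ℕtoℚ n                           ≤⟨ ℚ.*-cancelʳ-≤-pos (ℕtoℚ t) {{ℕtoℚ-pos 1≤t}} scaled ⟩
    ℕtoℚ n ℚ.* P ℚ.+ ℕtoℚ M          ≤⟨ ℚ.+-monoʳ-≤ (ℕtoℚ n ℚ.* P) M≤nε ⟩
    ℕtoℚ n ℚ.* P ℚ.+ ℕtoℚ n ℚ.* ε    ≡⟨ ℚ.*-distribˡ-+ (ℕtoℚ n) P ε ⟨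
    ℕtoℚ n ℚ.* (P ℚ.+ ε)             ∎))
  where
  open ℚ.≤-Reasoning
  scaled : ℕtoℚ n ℚ.* ℕtoℚ t ℚ.≤ (ℕtoℚ n ℚ.* P ℚ.+ ℕtoℚ M) ℚ.* ℕtoℚ t
  scaled = begin
    ℕtoℚ n ℚ.* ℕtoℚ t                              ≡⟨ ℕtoℚ-* n t ⟨
    ℕtoℚ (n * t)                                   ≤⟨ ℕtoℚ-mono h ⟩
    ℕtoℚ (n * g + M * t)                           ≡⟨ trans (ℕtoℚ-+ (n * g) (M * t)) (cong₂ ℚ._+_ (ℕtoℚ-* n g) (ℕtoℚ-* M t)) ⟩
    ℕtoℚ n ℚ.* ℕtoℚ g ℚ.+ ℕtoℚ M ℚ.* ℕtoℚ t        ≡⟨ cong (λ x → ℕtoℚ n ℚ.* x ℚ.+ ℕtoℚ M ℚ.* ℕtoℚ t) (trans (ℚ.*-comm P (ℕtoℚ t)) tP) ⟨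
    ℕtoℚ n ℚ.* (P ℚ.* ℕtoℚ t) ℚ.+ ℕtoℚ M ℚ.* ℕtoℚ t  ≡⟨ cong (ℚ._+ ℕtoℚ M ℚ.* ℕtoℚ t) (ℚ.*-assoc (ℕtoℚ n) P (ℕtoℚ t)) ⟨
    (ℕtoℚ n ℚ.* P) ℚ.* ℕtoℚ t ℚ.+ ℕtoℚ M ℚ.* ℕtoℚ t  ≡⟨ ℚ.*-distribʳ-+ (ℕtoℚ t) (ℕtoℚ n ℚ.* P) (ℕtoℚ M) ⟨
    (ℕtoℚ n ℚ.* P ℚ.+ ℕtoℚ M) ℚ.* ℕtoℚ t           ∎

prob-𝔼 : ∀ n p A B → ℕtoℚ (A + B) ℚ.* p ≡ ℕtoℚ A → ℕtoℚ (A + B) ℚ.* (1ℚ ℚ.- p) ≡ ℕtoℚ B → ∀ P →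
  ℕtoℚ ((A + B) ^ length (pairs n)) ℚ.* prob n p P ≡ ℕtoℚ (Expectation.𝔼 A B (pairs n) (𝟙 ∘ P))
prob-𝔼 n p A B Qp Qq P = mass-𝔼 p (1ℚ ℚ.- p) A B Qp Qq (pairs n) P

-- Here d = a / b.
module Density (d : ℚ) (a b D : ℕ) (1≤b : 1 ≤ b) (bd≡a : ℕtoℚ b ℚ.* d ≡ ℕtoℚ a)
               (10≤D : 10 ≤ D) (a≤Db : a ≤ D * b) (14Db≤16a : b * (14 * D) ≤ 16 * a) where

  ≤14D⇒≤16d : ∀ m → m ≤ 14 * D → ℕtoℚ m ℚ.≤ ℕtoℚ 16 ℚ.* d
  ≤14D⇒≤16d m m≤14D = ℚ.*-cancelˡ-≤-pos (ℕtoℚ b) {{ℕtoℚ-pos 1≤b}} (begin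
    ℕtoℚ b ℚ.* ℕtoℚ m                ≡⟨ ℕtoℚ-* b m ⟨
    ℕtoℚ (b * m)                     ≤⟨ ℕtoℚ-mono (≤-trans (*-monoʳ-≤ b m≤14D) 14Db≤16a) ⟩
    ℕtoℚ (16 * a)                    ≡⟨ ℕtoℚ-* 16 a ⟩
    ℕtoℚ 16 ℚ.* ℕtoℚ a               ≡⟨ cong (ℕtoℚ 16 ℚ.*_) bd≡a ⟨
    ℕtoℚ 16 ℚ.* (ℕtoℚ b ℚ.* d)       ≡⟨ swap-* (ℕtoℚ 16) (ℕtoℚ b) d ⟩
    ℕtoℚ b ℚ.* (ℕtoℚ 16 ℚ.* d)       ∎)
    where open ℚ.≤-Reasoning

  bn-edgeProb : ∀ n → 1 ≤ n → ℕtoℚ (b * n) ℚ.* edgeProb d n ≡ ℕtoℚ a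
  bn-edgeProb n@(suc m) _ = begin
    ℕtoℚ (b * n) ℚ.* (d ℚ.* r)                 ≡⟨ cong (ℚ._* (d ℚ.* r)) (ℕtoℚ-* b n) ⟩
    (ℕtoℚ b ℚ.* ℕtoℚ n) ℚ.* (d ℚ.* r)          ≡⟨ ℚ.*-assoc (ℕtoℚ b) (ℕtoℚ n) (d ℚ.* r) ⟩
    ℕtoℚ b ℚ.* (ℕtoℚ n ℚ.* (d ℚ.* r))          ≡⟨ cong (ℕtoℚ b ℚ.*_) (swap-* (ℕtoℚ n) d r) ⟩
    ℕtoℚ b ℚ.* (d ℚ.* (ℕtoℚ n ℚ.* r))          ≡⟨ cong (λ x → ℕtoℚ b ℚ.* (d ℚ.* x)) (suc-*-1/suc m) ⟩
    ℕtoℚ b ℚ.* (d ℚ.* 1ℚ)                      ≡⟨ cong (ℕtoℚ b ℚ.*_) (ℚ.*-identityʳ d) ⟩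
    ℕtoℚ b ℚ.* d                               ≡⟨ bd≡a ⟩
    ℕtoℚ a                                     ∎
    where
    open ≡-Reasoning
    r = (+ 1) ℚ./ suc m

  complement : ∀ Q A B p → A + B ≡ Q → ℕtoℚ Q ℚ.* p ≡ ℕtoℚ A → ℕtoℚ Q ℚ.* (1ℚ ℚ.- p) ≡ ℕtoℚ B
  complement Q A B p eq Qp = begin
    ℕtoℚ Q ℚ.* (1ℚ ℚ.- p)                      ≡⟨ ℚ.*-distribˡ-+ (ℕtoℚ Q) 1ℚ (ℚ.- p) ⟩
    ℕtoℚ Q ℚ.* 1ℚ ℚ.+ ℕtoℚ Q ℚ.* (ℚ.- p)       ≡⟨ cong₂ ℚ._+_ (ℚ.*-identityʳ (ℕtoℚ Q)) (sym (ℚ.neg-distribʳ-* (ℕtoℚ Q) p)) ⟩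
    ℕtoℚ Q ℚ.- ℕtoℚ Q ℚ.* p                    ≡⟨ cong₂ ℚ._-_ (trans (cong ℕtoℚ (trans (sym eq) (+-comm A B))) (ℕtoℚ-+ B A)) Qp ⟩
    (ℕtoℚ B ℚ.+ ℕtoℚ A) ℚ.- ℕtoℚ A             ≡⟨ x≡x+y-y (ℕtoℚ B) (ℕtoℚ A) ⟩
    ℕtoℚ B                                     ∎
    where open ≡-Reasoning

  probability-bound : ∀ ε n → D ≤ n → ℕtoℚ (scale D) ℚ.≤ ℕtoℚ n ℚ.* ε →
    1ℚ ℚ.- ε ℚ.≤ prob n (edgeProb d n) (degenerateᵇ n (ℕtoℚ 16 ℚ.* d) (ℕtoℚ 16 ℚ.* d))
  probability-bound ε n D≤n M≤nε =
    lower-bound-transfer n (scale D) (Q ^ length (pairs n))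
      (Expectation.𝔼 a B (pairs n) (λ E → 𝟙 (degenerateᵇ n d′ d′ E)))
      (prob n p (degenerateᵇ n d′ d′)) ε 1≤n (m^n≥1 (length (pairs n)) 1≤Q)
      (degenerate-likely n D a B 1≤n 10≤D an≤DQ d′ (λ m m≤ → T⇒true (ℚ.≤⇒≤ᵇ (≤14D⇒≤16d m m≤))))
      (prob-𝔼 n p a B Qp (complement Q a B p refl Qp) (degenerateᵇ n d′ d′))
      M≤nε
    where
    p = edgeProb d n
    d′ = ℕtoℚ 16 ℚ.* d
    -- A genuine difference, since a ≤ D b ≤ b n; that is, d / n ≤ 1. The edge probability is then a
    -- / Q with Q = b n.
    B = b * n ∸ a
    Q = a + B
    1≤n : 1 ≤ n
    1≤n = ≤-trans (≤-trans (s≤s z≤n) 10≤D) D≤n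
    T⇒true : ∀ {b} → T b → b ≡ true
    T⇒true {true} _ = refl
    a≤bn : a ≤ b * n
    a≤bn = ≤-trans a≤Db (≤-trans (≤-reflexive (*-comm D b)) (*-monoʳ-≤ b D≤n))
    Q≡bn : Q ≡ b * n
    Q≡bn = m+[n∸m]≡n a≤bn
    1≤Q : 1 ≤ Q
    1≤Q = subst (1 ≤_) (sym Q≡bn) (*-mono-≤ 1≤b 1≤n)
    Qp : ℕtoℚ Q ℚ.* p ≡ ℕtoℚ a
    Qp = trans (cong (λ q → ℕtoℚ q ℚ.* p) Q≡bn) (bn-edgeProb n 1≤n)
    an≤DQ : a * n ≤ D * Q
    an≤DQ = ≤-trans (*-monoˡ-≤ n a≤Db) (≤-reflexive (trans (*-assoc D b n) (cong (D *_) (sym Q≡bn))))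

  almostSurely : AlmostSurely d (λ n → degenerateᵇ n (ℕtoℚ 16 ℚ.* d) (ℕtoℚ 16 ℚ.* d))
  -- For ε = (e + 1) / (f + 1), the first summand of the threshold gives `scale D` ≤ n ε, and the
  -- second gives d ≤ D ≤ n, so that d / n is a probability.
  almostSurely (mkℚ (+ suc e) f c) _ = scale D * suc f + D , λ n N≤n →
    probability-bound (mkℚ (+ suc e) f c) n (m+n≤o⇒n≤o (scale D * suc f) N≤n) (large n (m+n≤o⇒m≤o (scale D * suc f) N≤n))
    where
    open ℚ.≤-Reasoning
    large : ∀ n → scale D * suc f ≤ n → ℕtoℚ (scale D) ℚ.≤ ℕtoℚ n ℚ.* mkℚ (+ suc e) f c
    large n h = begin
      ℕtoℚ (scale D)                                                ≤⟨ ℕtoℚ-mono (m≤m*n (scale D) (suc e)) ⟩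
      ℕtoℚ (scale D * suc e)                                        ≡⟨ ℕtoℚ-* (scale D) (suc e) ⟩
      ℕtoℚ (scale D) ℚ.* ℕtoℚ (suc e)                               ≡⟨ cong (ℕtoℚ (scale D) ℚ.*_) (denominator-* (suc e) f c) ⟨
      ℕtoℚ (scale D) ℚ.* (ℕtoℚ (suc f) ℚ.* mkℚ (+ suc e) f c)       ≡⟨ ℚ.*-assoc (ℕtoℚ (scale D)) (ℕtoℚ (suc f)) _ ⟨
      (ℕtoℚ (scale D) ℚ.* ℕtoℚ (suc f)) ℚ.* mkℚ (+ suc e) f c       ≡⟨ cong (ℚ._* mkℚ (+ suc e) f c) (ℕtoℚ-* (scale D) (suc f)) ⟨
      ℕtoℚ (scale D * suc f) ℚ.* mkℚ (+ suc e) f c                  ≤⟨ ℚ.*-monoʳ-≤-nonNeg (mkℚ (+ suc e) f c) (ℕtoℚ-mono h) ⟩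
      ℕtoℚ n ℚ.* mkℚ (+ suc e) f c                                  ∎
  almostSurely (mkℚ (+ zero) f c) (*<* (ℤ.+<+ ()))
  almostSurely (mkℚ -[1+ e ] f c) (*<* ())

-- Rounding d to an integer.

module _ (a b : ℕ) .{{_ : NonZero b}} where

  m≤[1+m/n]*n : a ≤ suc (a / b) * b
  m≤[1+m/n]*n = ≤-trans (≤-reflexive (m≡m%n+[m/n]*n a b)) (+-monoˡ-≤ (a / b * b) (<⇒≤ (m%n<n a b)))

  -- In terms of d = a / b: 14 (⌊d⌋ + 1) ≤ 14 d + 14, and 14 ≤ 20 ≤ 2 d because d ≥ 10.
  14[1+m/n]n≤16m : 10 * b ≤ a → b * (14 * suc (a / b)) ≤ 16 * a
  14[1+m/n]n≤16m 10b≤a = begin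
    b * (14 * suc (a / b))       ≡⟨ e₁ b (a / b) 14 ⟩
    14 * (a / b * b) + 14 * b    ≤⟨ +-mono-≤ (*-monoʳ-≤ 14 (m/n*n≤m a b)) (≤-trans (≤-trans (*-monoˡ-≤ b (m≤m+n 14 6)) (≤-reflexive (*-assoc 2 10 b))) (*-monoʳ-≤ 2 10b≤a)) ⟩
    14 * a + 2 * a               ≡⟨ *-distribʳ-+ a 14 2 ⟨
    16 * a                       ∎
    where
    open ≤-Reasoning
    e₁ : ∀ b c k → b * (k * (1 + c)) ≡ k * (c * b) + k * b
    e₁ = solve-∀

theorem4p8 : (d : ℚ) → ((+ 10) ℚ./ 1) ℚ.≤ d →
    AlmostSurely d (λ n → degenerateᵇ n (((+ 16) ℚ./ 1) ℚ.* d) (((+ 16) ℚ./ 1) ℚ.* d))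
theorem4p8 d@(mkℚ (+ a) b-1 c) (*≤* 10b≤a) =
  Density.almostSurely d a b (suc (a / b)) (s≤s z≤n) (denominator-* a b-1 c)
    (*-cancelʳ-≤ 10 (suc (a / b)) b (≤-trans 10b≤a′ (m≤[1+m/n]*n a b))) (m≤[1+m/n]*n a b) (14[1+m/n]n≤16m a b 10b≤a′)
  where
  b = suc b-1
  10b≤a′ : 10 * b ≤ a
  10b≤a′ = ℤ.drop‿+≤+ (subst₂ ℤ._≤_ (sym (ℤ.pos-* 10 b)) (ℤ.*-identityʳ (+ a)) 10b≤a)
theorem4p8 (mkℚ -[1+ a ] b c) (*≤* ())
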